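{- Let $k\ge 3$ be a constant. There exist absolute constants $\alpha,\beta>0$ such that the following holds. Let $M$ be an $r\times t$ matrix with entries in $\{1,\dots,n\}$, with $f_1\le 0.1F_1$, and suppose that, with $$\psi=\frac{n^{1-(1/k)}G_k^{1/k}}{F_1},\qquad \delta=2^{\lceil 0.5\log_2\psi\rceil},$$ one has $$t=\left\lceil\frac{\delta F_1}{n^{1/k}}\right\rceil,\qquad \lambda=\left\lceil\frac{F_1\delta^3}{n}\right\rceil .$$ If $$\alpha G_k^{1/k}\le f_1\le \beta t,$$ then the pick-and-drop sample $S_r$ of $M$ with parameter $\lambda$ satisfies $$P(S_r=1)\ge \frac{\delta}{2n^{1-(2/k)}}.$$
   Context: Write $[N]=\{1,\dots,N\}$. Let $M$ be a matrix with $r$ rows and $t$ columns and entries $m_{i,j}\in[n]$. For $i\in[r]$, $j\in[t]$, $l\in[n]$ define - $d_{i,j}=|\{j': j\le j'\le t,\ m_{i,j'}=m_{i,j}\}|$, - $f_{l,i}=|\{j\in[t]: m_{i,j}=l\}|$ (frequency of $l$ in row $i$), - $f_l=|\{(i,j): m_{i,j}=l\}|$ (frequency of $l$ in $M$), - $F_k=\sum_{l=1}^n f_l^k$ and $G_k=F_k-f_1^k$. In particular $F_1=rt$. Pick-and-drop sampling with parameter $\lambda$: let $I_1,\dots,I_r$ be i.i.d. uniform on $[t]$, and set $s_i=m_{i,I_i}$, $c_i=d_{i,I_i}$ for $i\in[r]$. Define $S_1=s_1$, $C_1=c_1$, $q_1=1$. For $i=2,\dots,r$: if $C_{i-1}<\max\{\lambda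 q_{i-1},c_i\}$ then set $S_i=s_i$, $C_i=c_i$, $q_i=1$; otherwise set $S_i=S_{i-1}$, $C_i=C_{i-1}+f_{S_i,i}$, $q_i=q_{i-1}+1$. -}

module Defs where

open import Data.Bool.Base using (if_then_else_)
open import Data.Fin.Base using (Fin; zero; suc)
import Data.Fin.Base as Fin
import Data.Fin.Properties as Fin
open import Data.Integer.Base as ℤ using (ℤ; +_; -[1+_])
import Data.Integer.Properties as ℤ
open import Data.List.Base using (List; []; _∷_; length; filter; allFin; cartesianProduct; cartesianProductWith)
open import Data.List.Membership.Propositional using (lose)
open import Data.List.Membership.Propositional.Properties using (∈-allFin; ∈-cartesianProduct⁺)
open import Data.List.Properties using (filter-some)
open import Data.Nat.Base as ℕ using (ℕ; zero; suc; _⊔_; _∸_)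
import Data.Nat.Properties as ℕ
open import Data.Product.Base using (_×_; _,_)
open import Data.Rational.Unnormalised.Base as ℚ using (ℚᵘ; mkℚᵘ; _/_; 0ℚᵘ)
import Data.Rational.Unnormalised.Properties as ℚ
open import Data.Vec.Base using (Vec; []; _∷_; lookup)
open import Data.Vec.Functional using (foldl)
open import Function.Base using (it)
open import Relation.Binary.PropositionalEquality using (_≡_; refl)
open import Relation.Nullary.Decidable using (⌊_⌋; _×-dec_)
open import Relation.Unary using (Decidable)
open import Algebra.Definitions.RawSemiring ℚ.+-*-rawSemiring using () renaming (_^_ to _^ℚ_)
open import Algebra.Properties.CommutativeMonoid.Sum ℕ.+-0-commutativeMonoid
  using (sum-syntax; sum-remove)

------------------------------------------------------------------------
-- Real numbers of the form ρ^{1/k} with ρ a nonnegative rational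

-- The real number represented by an element of `Surd k` is the
-- nonnegative k-th root of its radicand.  For k ≥ 1 these reals include
-- the nonnegative rationals and are closed under products and quotients.
-- As x ↦ x^k is a multiplicative order embedding on the nonnegative reals,
-- these operations and the order are computed exactly on radicands.
-- A real constant that may be enlarged (or shrunk, staying positive) at
-- will can be taken among them, since they include the positive rationals.

record Surd (k : ℕ) : Set where
  constructor root
  field
    radicand    : ℚᵘ
    .{{nonNeg}} : ℚ.NonNegative radicand

open Surd public using (radicand)

private variable k : ℕ

infix  4 _≤ˢ_ _<ˢ_
infixl 7 _·_ _÷_
infix  8 _^[_/_]

_≤ˢ_ _<ˢ_ : Surd k → Surd k → Set
x ≤ˢ y = radicand x ℚ.≤ radicand y
x <ˢ y = radicand x ℚ.< radicand y

_·_ : Surd k → Surd k → Surd k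
root p · root q = root (p ℚ.* q) {{ℚ.nonNeg*nonNeg⇒nonNeg p q}}

record NonZeroˢ (x : Surd k) : Set where
  constructor nonZeroˢ
  field nonZero : ℚ.NonZero (radicand x)

_÷_ : (x y : Surd k) → .{{NonZeroˢ y}} → Surd k
(root p ÷ root q) {{q≢0}} =
  root ((p ℚ.÷ q) {{NonZeroˢ.nonZero q≢0}}) {{÷-nonNeg p q {{q≢0 = NonZeroˢ.nonZero q≢0}}}}
  where
  ÷-nonNeg : ∀ p q .{{_ : ℚ.NonNegative p}} .{{_ : ℚ.NonNegative q}}
             .{{q≢0 : ℚ.NonZero q}} → ℚ.NonNegative (p ℚ.÷ q)
  ÷-nonNeg p@record{} q@(mkℚᵘ ℤ.+[1+ _ ] _) = ℚ.nonNeg*nonNeg⇒nonNeg p (ℚ.1/ q)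

^ℚ-nonNeg : ∀ p .{{_ : ℚ.NonNegative p}} a → ℚ.NonNegative (p ^ℚ a)
^ℚ-nonNeg p zero    = _
^ℚ-nonNeg p (suc a) = ℚ.nonNeg*nonNeg⇒nonNeg p (p ^ℚ a) {{^ℚ-nonNeg p a}}

*-nonZero : ∀ p q .{{_ : ℚ.NonZero p}} .{{_ : ℚ.NonZero q}} → ℚ.NonZero (p ℚ.* q)
*-nonZero p@record{} q@record{} = ℤ.i*j≢0 (ℚᵘ.numerator p) (ℚᵘ.numerator q)

^ℚ-nonZero : ∀ p .{{_ : ℚ.NonZero p}} a → ℚ.NonZero (p ^ℚ a)
^ℚ-nonZero p zero    = _
^ℚ-nonZero p (suc a) = *-nonZero p (p ^ℚ a) {{it}} {{^ℚ-nonZero p a}}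

0ˢ : Surd k
0ˢ = root 0ℚᵘ

-- The rational q, as the k-th root of q ^ k.
⟦_⟧ : (q : ℚᵘ) → .{{ℚ.NonNegative q}} → Surd k
⟦_⟧ {k} q = root (q ^ℚ k) {{^ℚ-nonNeg q k}}

⟪_⟫ : ℕ → Surd k
⟪ m ⟫ = ⟦ + m / 1 ⟧

-- The real number m^{a/k}.
_^[_/_] : ℕ → ℕ → (k : ℕ) → Surd k
m ^[ a / k ] = root (+ (m ℕ.^ a) / 1)

-- m = ⌈ x ⌉
_IsCeilingOf_ : ℕ → Surd k → Set
m IsCeilingOf x = x ≤ˢ ⟪ m ⟫ × (∀ m′ → x ≤ˢ ⟪ m′ ⟫ → m ℕ.≤ m′)

2^ : ℤ → ℚᵘ
2^ (+ a)    = + (2 ℕ.^ a) / 1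
2^ -[1+ a ] = (+ 1 / (2 ℕ.^ suc a)) {{ℕ.m^n≢0 2 (suc a)}}

/-nonNeg : ∀ m d .{{_ : ℕ.NonZero d}} → ℚ.NonNegative (+ m / d)
/-nonNeg m (suc _) = _

2^-nonNeg : ∀ e → ℚ.NonNegative (2^ e)
2^-nonNeg (+ a)    = _
2^-nonNeg -[1+ a ] = /-nonNeg 1 (2 ℕ.^ suc a) {{ℕ.m^n≢0 2 (suc a)}}

2^ˢ : ℤ → Surd k
2^ˢ e = ⟦ 2^ e ⟧ {{2^-nonNeg e}}

-- e = ⌈ ½ log₂ x ⌉, where ½ log₂ x ≤ e is the inequality x ≤ 2^{2e}.
_Is⌈½log₂_⌉ : ℤ → Surd k → Set
e Is⌈½log₂ x ⌉ = x ≤ˢ 2^ˢ (e ℤ.+ e) × (∀ e′ → x ≤ˢ 2^ˢ (e′ ℤ.+ e′) → e ℤ.≤ e′)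

⟪⟫-nonZero : ∀ m .{{_ : ℕ.NonZero m}} → NonZeroˢ {k} ⟪ m ⟫
⟪⟫-nonZero {k} m = nonZeroˢ (^ℚ-nonZero (+ m / 1) k)

^[/]-nonZero : ∀ m a k .{{_ : ℕ.NonZero m}} → NonZeroˢ (m ^[ a / k ])
^[/]-nonZero m a k = nonZeroˢ (ℕ.m^n≢0 m a)

·-nonZero : {x y : Surd k} → NonZeroˢ x → NonZeroˢ y → NonZeroˢ (x · y)
·-nonZero {x = x} {y} (nonZeroˢ x≢0) (nonZeroˢ y≢0) =
  nonZeroˢ (*-nonZero (radicand x) (radicand y) {{x≢0}} {{y≢0}})

------------------------------------------------------------------------
-- Matrices and frequencies

-- The entry l ∈ {1,…,n} is the element of Fin n with toℕ = l - 1.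
Matrix : ℕ → ℕ → ℕ → Set
Matrix r t n = Fin r → Fin t → Fin n

one : ∀ {n} .{{_ : ℕ.NonZero n}} → Fin n
one {suc _} = zero

module _ {r t n : ℕ} (M : Matrix r t n) where

  d : Fin r → Fin t → ℕ
  d i j = length (filter (λ j′ → (j Fin.≤? j′) ×-dec (M i j′ Fin.≟ M i j)) (allFin t))

  rowFreq : Fin n → Fin r → ℕ
  rowFreq l i = length (filter (λ j → M i j Fin.≟ l) (allFin t))

  freq : Fin n → ℕ
  freq l = length (filter (λ (i , j) → M i j Fin.≟ l) (cartesianProduct (allFin r) (allFin t)))

  F : ℕ → ℕ
  F k = ∑[ l < n ] (freq l ℕ.^ k)

  f₁ : .{{ℕ.NonZero n}} → ℕ
  f₁ = freq one

  -- The truncated subtraction is exact, since f₁ ^ k is a summand of F k.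
  G : .{{ℕ.NonZero n}} → ℕ → ℕ
  G k = F k ∸ f₁ ℕ.^ k

F₁-nonZero : ∀ {r t n} .{{_ : ℕ.NonZero r}} .{{_ : ℕ.NonZero t}} (M : Matrix r t n) → ℕ.NonZero (F M 1)
F₁-nonZero {suc _} {suc _} {suc _} M = ℕ.>-nonZero (begin-strict
  0                      <⟨ filter-some (λ (i , j) → M i j Fin.≟ l)
                              (lose (∈-cartesianProduct⁺ (∈-allFin zero) (∈-allFin zero)) refl) ⟩
  freq M l               ≡⟨ ℕ.^-identityʳ (freq M l) ⟨
  freq M l ℕ.^ 1         ≤⟨ ℕ.m≤m+n _ _ ⟩
  _                      ≡⟨ sum-remove {i = l} (λ l′ → freq M l′ ℕ.^ 1) ⟨
  F M 1                  ∎)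
  where
  open ℕ.≤-Reasoning
  l = M zero zero
F₁-nonZero {n = zero} {{r≢0}} {{t≢0}} M = noEntry (M (one {{r≢0}}) (one {{t≢0}}))
  where
  noEntry : Fin 0 → _
  noEntry ()

-- ψ = n^{1-1/k} G_k^{1/k} / F₁
ψ : ∀ {r t n} .{{_ : ℕ.NonZero r}} .{{_ : ℕ.NonZero t}} .{{_ : ℕ.NonZero n}}
    (k : ℕ) → Matrix r t n → Surd k
ψ {n = n} k M = (n ^[ k ∸ 1 / k ] · G M k ^[ 1 / k ]) ÷ ⟪ F M 1 ⟫
  where instance _ = ⟪⟫-nonZero (F M 1) {{F₁-nonZero M}}

-- δ F₁ / n^{1/k} for δ = 2^e
tReal : ∀ {r t n} .{{_ : ℕ.NonZero n}} (k : ℕ) → Matrix r t n → (e : ℤ) → Surd k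
tReal {n = n} k M e = (2^ˢ e · ⟪ F M 1 ⟫) ÷ n ^[ 1 / k ]
  where instance _ = ^[/]-nonZero n 1 k

-- F₁ δ³ / n for δ = 2^e
lamReal : ∀ {r t n} .{{_ : ℕ.NonZero n}} → Matrix r t n → (e : ℤ) → ℚᵘ
lamReal {n = n} M e = ((+ F M 1 / 1) ℚ.* (2^ e ^ℚ 3)) ℚ.÷ (+ n / 1)

-- δ / (2 n^{1-2/k}) for δ = 2^e
threshold : (k n : ℕ) .{{_ : ℕ.NonZero n}} → (e : ℤ) → Surd k
threshold k n e = 2^ˢ e ÷ (⟪ 2 ⟫ · n ^[ k ∸ 2 / k ])
  where instance _ = ·-nonZero (⟪⟫-nonZero 2) (^[/]-nonZero n (k ∸ 2) k)

------------------------------------------------------------------------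
-- Pick-and-drop sampling

-- The triple (S_i, C_i, q_i).
record State (n : ℕ) : Set where
  constructor state
  field
    S : Fin n
    C : ℕ
    q : ℕ

open State public

module _ {r t n : ℕ} (M : Matrix r t n) (lam : ℕ) where

  restart : Fin r → Fin t → State n
  restart i j = state (M i j) (d M i j) 1

  step : State n → Fin r → Fin t → State n
  step (state S C q) i j =
    if ⌊ C ℕ.<? (lam ℕ.* q) ⊔ d M i j ⌋
    then restart i j
    else state S (C ℕ.+ rowFreq M S i) (suc q)

-- The state after the last row, for column choices I.  The vector folded
-- over, `suc : Fin r → Fin (suc r)`, lists the rows after the first.
finalState : ∀ {r t n} .{{_ : ℕ.NonZero r}} → Matrix r t n → ℕ → Vec (Fin t) r → State n
finalState {suc r} M lam I =
  foldl (λ s i → step M lam s i (lookup I i))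
        (restart M lam zero (lookup I zero)) {r} suc

outcomes : ∀ t r → List (Vec (Fin t) r)
outcomes t zero    = [] ∷ []
outcomes t (suc r) = cartesianProductWith _∷_ (allFin t) (outcomes t r)

-- Independent uniform choices I_1,…,I_r on [t] amount to the uniform
-- distribution on [t]^r.
ℙ : ∀ {t r} .{{_ : ℕ.NonZero t}} {E : Vec (Fin t) r → Set} → Decidable E → ℚᵘ
ℙ {t} {r} E? = (+ length (filter E? (outcomes t r)) / (t ℕ.^ r)) {{ℕ.m^n≢0 t r}}

ℙ-nonNeg : ∀ {t r} .{{_ : ℕ.NonZero t}} {E : Vec (Fin t) r → Set} (E? : Decidable E) →
           ℚ.NonNegative (ℙ E?)
ℙ-nonNeg {t} {r} E? =
  /-nonNeg (length (filter E? (outcomes t r))) (t ℕ.^ r) {{ℕ.m^n≢0 t r}}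

-- P(S_r = 1)
ℙ[S≡1] : ∀ {r t n} .{{_ : ℕ.NonZero r}} .{{_ : ℕ.NonZero t}} .{{_ : ℕ.NonZero n}} →
         Matrix r t n → ℕ → Surd k
ℙ[S≡1] {r = r} {t} M lam = ⟦ ℙ S≡1? ⟧ {{ℙ-nonNeg S≡1?}}
  where
  S≡1? : Decidable (λ (I : Vec (Fin t) r) → S (finalState M lam I) ≡ one)
  S≡1? I = S (finalState M lam I) Fin.≟ one

{-# OPTIONS --safe #-}

-- Call the cells (i , I i) selected by an outcome I, and call an occurrence of
-- 1 good if the counter started there never falls below lam * q.  The sample
-- ends in 1 as soon as some selected good occurrence x of 1 conflicts with no
-- other selected cell y, where y conflicts with x if y could reject x (y earlier),
-- if y replaces x (y later), or if y is an occurrence of 1 too;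
-- by the last clause at most one such x exists.  Hence
--   #(selected good cells) ≤ [S = 1] + #(selected conflicts),
-- and averaging over I gives t² P(S = 1) ≥ t #good − #conflicts.  All but
-- lam * r occurrences of 1 are good, and there are at most
-- f₁² + G₃ / lam + F₂ conflicts.  By log-convexity of the moments,
-- G₂² ≤ G₁ G₃ and G₃ ^ k ≤ n ^ (k - 3) G_k³, so the choice of δ, t and lam makes
-- all losses together at most f₁ t / 2, whence P(S = 1) ≥ f₁ / 2t.

module Submission where

open import Defs
open import Data.Bool.Base using (if_then_else_; true; false)
open import Data.Fin.Base using (Fin; zero; suc; toℕ)
import Data.Fin.Base as Fin
import Data.Fin.Properties as Fin
open import Data.Integer.Base as ℤ using (ℤ; +_; -[1+_]; +[1+_])
import Data.Integer.DivMod as ℤ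
import Data.Integer.Properties as ℤ
open import Data.Integer.Tactic.RingSolver using () renaming (solve-∀ to ℤ-solve-∀)
open import Data.List.Base as List using ([]; _∷_; length; filter; allFin; cartesianProductWith)
import Data.List.Properties as List
open import Data.Nat.Base using (ℕ; zero; suc; NonZero; ≢-nonZero; ≢-nonZero⁻¹; >-nonZero; >-nonZero⁻¹; _+_; _*_; _^_; _∸_; _⊓_; _⊔_; _≤_; _<_; z≤n; s≤s; z<s; s<s; s≤s⁻¹)
import Data.Nat.Properties as ℕ
open import Data.Nat.Tactic.RingSolver using (solve-∀)
open import Data.Product.Base using (∃₂; _×_; _,_; proj₁; proj₂)
open import Data.Rational.Unnormalised.Base as ℚ using (ℚᵘ; mkℚᵘ; _/_; ceiling; _≃_; *≡*; *≤*)
import Data.Rational.Unnormalised.Properties as ℚ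
open import Data.Sum.Base using (_⊎_; inj₁; inj₂)
open import Data.Vec.Base using (Vec; []; _∷_; lookup)
open import Data.Vec.Functional using (foldl)
open import Function.Base using (_∘_; id)
open import Relation.Binary.PropositionalEquality using (_≡_; _≢_; refl; sym; trans; cong; cong₂; subst; subst₂; module ≡-Reasoning)
open import Relation.Nullary.Decidable using (Dec; yes; no; does; ¬?; _×-dec_; _⊎-dec_; dec-true; dec-false; decidable-stable)
open import Relation.Nullary.Negation using (¬_; contradiction)
open import Relation.Unary using (Decidable)
open import Algebra.Definitions.RawSemiring ℚ.+-*-rawSemiring using () renaming (_^_ to _^ℚ_)
open import Algebra.Properties.CommutativeMonoid.Sum ℕ.+-0-commutativeMonoid using (sum; sum-syntax; sum-cong-≗; ∑-comm; ∑-distrib-+)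
open import Algebra.Properties.Semiring.Sum ℕ.+-*-semiring using (*-distribˡ-sum; *-distribʳ-sum)

-- Whether a selected cell survives depends on the whole outcome, while averaging uses only the
-- independence of two rows. Conflicts are therefore made coarse enough to be read off two cells. A
-- counter grows by row frequencies only, so with value `l` it never exceeds the frequency of `l`;
-- an earlier cell with value `l` can thus reject x only if this frequency is at least `d` of x and
-- at least `lam` times the row distance. Once x is sampled, its counter before each later row is
-- determined by x. This decides the test against `d` cell by cell and leaves the test against
-- `lam * q` to x alone, as goodness. The bound f₁ / 2t suffices because rounding gives ψ ≤ δ² ≤ 4ψ
-- and t ≤ 2 δ F₁ / n^(1/k), so that f₁ ≥ α G_k^(1/k) implies f₁ / 2t ≥ (α / 16) δ / n^(1 - 2/k).
-- All these quantities are k-th roots of rationals, so each estimate is raised to the power k,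
-- cleared of denominators and proved in ℕ.

private variable
  Φ Ψ : Set
  r t n : ℕ

-- Indicators and sums

𝟙 : Dec Φ → ℕ
𝟙 Φ? = if does Φ? then 1 else 0

𝟙-true : (Φ? : Dec Φ) → Φ → 𝟙 Φ? ≡ 1
𝟙-true Φ? p rewrite dec-true Φ? p = refl

𝟙-false : (Φ? : Dec Φ) → ¬ Φ → 𝟙 Φ? ≡ 0
𝟙-false Φ? ¬p rewrite dec-false Φ? ¬p = refl

𝟙≤ : ∀ (Φ? : Dec Φ) {m} → (Φ → 1 ≤ m) → 𝟙 Φ? ≤ m
𝟙≤ (yes p) h = h p
𝟙≤ (no _)  h = z≤n

𝟙-mono : (Φ? : Dec Φ) (Ψ? : Dec Ψ) → (Φ → Ψ) → 𝟙 Φ? ≤ 𝟙 Ψ?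
𝟙-mono Φ? Ψ? f = 𝟙≤ Φ? λ p → ℕ.≤-reflexive (sym (𝟙-true Ψ? (f p)))

𝟙-cong : (Φ? : Dec Φ) (Ψ? : Dec Ψ) → (Φ → Ψ) → (Ψ → Φ) → 𝟙 Φ? ≡ 𝟙 Ψ?
𝟙-cong Φ? Ψ? f g = ℕ.≤-antisym (𝟙-mono Φ? Ψ? f) (𝟙-mono Ψ? Φ? g)

𝟙-⊎ : (Φ? : Dec Φ) (Ψ? : Dec Ψ) → 𝟙 (Φ? ⊎-dec Ψ?) ≤ 𝟙 Φ? + 𝟙 Ψ?
𝟙-⊎ (yes _) _ = s≤s z≤n
𝟙-⊎ (no _)  _ = ℕ.≤-refl

𝟙-× : (Φ? : Dec Φ) (Ψ? : Dec Ψ) → 𝟙 (Φ? ×-dec Ψ?) ≡ 𝟙 Φ? * 𝟙 Ψ?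
𝟙-× (yes _) _ = sym (ℕ.+-identityʳ _)
𝟙-× (no _)  _ = refl

sum-mono-≤ : ∀ {m} {f g : Fin m → ℕ} → (∀ i → f i ≤ g i) → sum f ≤ sum g
sum-mono-≤ {zero}  f≤g = z≤n
sum-mono-≤ {suc m} f≤g = ℕ.+-mono-≤ (f≤g zero) (sum-mono-≤ (f≤g ∘ suc))

sum-const : ∀ m c → ∑[ _ < m ] c ≡ m * c
sum-const zero    c = refl
sum-const (suc m) c = cong (λ z → c + z) (sum-const m c)

sum-zero : ∀ m → ∑[ _ < m ] 0 ≡ 0
sum-zero m = trans (sum-const m 0) (ℕ.*-zeroʳ m)

term≤sum : ∀ {m} (f : Fin m → ℕ) i → f i ≤ sum f
term≤sum f zero    = ℕ.m≤m+n _ _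
term≤sum f (suc i) = ℕ.≤-trans (term≤sum (f ∘ suc) i) (ℕ.m≤n+m _ _)

sum-𝟙≟ : ∀ {m} (i : Fin m) (f : Fin m → ℕ) → ∑[ j < m ] (𝟙 (i Fin.≟ j) * f j) ≡ f i
sum-𝟙≟ {suc m} zero f = begin
  f zero + 0 + ∑[ j < m ] 0  ≡⟨ cong (λ z → f zero + 0 + z) (sum-zero m) ⟩
  f zero + 0 + 0             ≡⟨ trans (ℕ.+-identityʳ _) (ℕ.+-identityʳ _) ⟩
  f zero                     ∎
  where open ≡-Reasoning
sum-𝟙≟ {suc m} (suc i) f = begin
  ∑[ j < m ] (𝟙 (suc i Fin.≟ suc j) * f (suc j))
    ≡⟨ sum-cong-≗ (λ j → cong (_* f (suc j)) (𝟙-cong (suc i Fin.≟ suc j) (i Fin.≟ j) Fin.suc-injective (cong suc))) ⟩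
  ∑[ j < m ] (𝟙 (i Fin.≟ j) * f (suc j))          ≡⟨ sum-𝟙≟ i (f ∘ suc) ⟩
  f (suc i)                                       ∎
  where open ≡-Reasoning

length-filter-tabulate : ∀ {A : Set} {m} {R : A → Set} (R? : Decidable R) (f : Fin m → A) →
  length (filter R? (List.tabulate f)) ≡ ∑[ i < m ] 𝟙 (R? (f i))
length-filter-tabulate {m = zero}  R? f = refl
length-filter-tabulate {m = suc m} R? f with does (R? (f zero))
... | true  = cong suc (length-filter-tabulate R? (f ∘ suc))
... | false = length-filter-tabulate R? (f ∘ suc)

length-filter-map : ∀ {A B : Set} {R : B → Set} (R? : Decidable R) (f : A → B) xs →
  length (filter R? (List.map f xs)) ≡ length (filter (R? ∘ f) xs)
length-filter-map R? f []       = refl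
length-filter-map R? f (x ∷ xs) with does (R? (f x))
... | true  = cong suc (length-filter-map R? f xs)
... | false = length-filter-map R? f xs

length-filter-cartesian : ∀ {A B C : Set} {m} {R : C → Set} (R? : Decidable R)
  (f : A → B → C) (g : Fin m → A) ys →
  length (filter R? (cartesianProductWith f (List.tabulate g) ys))
    ≡ ∑[ i < m ] length (filter (R? ∘ f (g i)) ys)
length-filter-cartesian {m = zero}  R? f g ys = refl
length-filter-cartesian {m = suc m} R? f g ys = begin
  length (filter R? (List.map (f (g zero)) ys List.++ zs))
    ≡⟨ cong length (List.filter-++ R? (List.map (f (g zero)) ys) zs) ⟩
  length (filter R? (List.map (f (g zero)) ys) List.++ filter R? zs)
    ≡⟨ List.length-++ (filter R? (List.map (f (g zero)) ys)) ⟩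
  length (filter R? (List.map (f (g zero)) ys)) + length (filter R? zs)
    ≡⟨ cong₂ _+_ (length-filter-map R? (f (g zero)) ys) (length-filter-cartesian R? f (g ∘ suc) ys) ⟩
  ∑[ i < suc m ] length (filter (R? ∘ f (g i)) ys) ∎
  where
  open ≡-Reasoning
  zs = cartesianProductWith f (List.tabulate (g ∘ suc)) ys

-- Sums over all outcomes, and independence of rows

∑ᵒ : ∀ r → (Vec (Fin t) r → ℕ) → ℕ
∑ᵒ zero    f = f []
∑ᵒ {t} (suc r) f = ∑[ j < t ] ∑ᵒ r (λ I → f (j ∷ I))

length-filter-outcomes : ∀ {t} r {E : Vec (Fin t) r → Set} (E? : Decidable E) →
  length (filter E? (outcomes t r)) ≡ ∑ᵒ r (λ I → 𝟙 (E? I))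
length-filter-outcomes zero    E? with does (E? [])
... | true  = refl
... | false = refl
length-filter-outcomes {t} (suc r) E? =
  trans (length-filter-cartesian E? _∷_ id (outcomes t r))
        (sum-cong-≗ (λ j → length-filter-outcomes r (λ I → E? (j ∷ I))))

∑ᵒ-mono-≤ : ∀ r {f g : Vec (Fin t) r → ℕ} → (∀ I → f I ≤ g I) → ∑ᵒ r f ≤ ∑ᵒ r g
∑ᵒ-mono-≤ zero    f≤g = f≤g []
∑ᵒ-mono-≤ (suc r) f≤g = sum-mono-≤ (λ j → ∑ᵒ-mono-≤ r (λ I → f≤g (j ∷ I)))

∑ᵒ-+ : ∀ r (f g : Vec (Fin t) r → ℕ) → ∑ᵒ r (λ I → f I + g I) ≡ ∑ᵒ r f + ∑ᵒ r g
∑ᵒ-+ zero    f g = refl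
∑ᵒ-+ (suc r) f g = trans (sum-cong-≗ (λ j → ∑ᵒ-+ r (λ I → f (j ∷ I)) (λ I → g (j ∷ I))))
  (∑-distrib-+ (λ j → ∑ᵒ r (λ I → f (j ∷ I))) (λ j → ∑ᵒ r (λ I → g (j ∷ I))))

∑ᵒ-const : ∀ r c → ∑ᵒ {t} r (λ _ → c) ≡ t ^ r * c
∑ᵒ-const zero    c = sym (ℕ.*-identityˡ c)
∑ᵒ-const {t} (suc r) c = begin
  ∑[ _ < t ] ∑ᵒ {t} r (λ _ → c)  ≡⟨ sum-cong-≗ (λ (_ : Fin t) → ∑ᵒ-const r c) ⟩
  ∑[ _ < t ] (t ^ r * c)         ≡⟨ sum-const t _ ⟩
  t * (t ^ r * c)                ≡⟨ ℕ.*-assoc t (t ^ r) c ⟨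
  t ^ suc r * c                  ∎
  where open ≡-Reasoning

∑ᵒ-∑ : ∀ r {m} (f : Fin m → Vec (Fin t) r → ℕ) → ∑ᵒ r (λ I → ∑[ i < m ] f i I) ≡ ∑[ i < m ] ∑ᵒ r (f i)
∑ᵒ-∑ zero    f = refl
∑ᵒ-∑ (suc r) f = trans (sum-cong-≗ (λ j → ∑ᵒ-∑ r (λ i I → f i (j ∷ I))))
  (∑-comm (λ j i → ∑ᵒ r (λ I → f i (j ∷ I))))

-- One choice is uniform, so `g` has mean `sum g / t` over the `t ^ r` outcomes; both denominators
-- are cleared.
∑ᵒ-one : ∀ r (i : Fin r) (g : Fin t → ℕ) → t * ∑ᵒ r (λ I → g (lookup I i)) ≡ t ^ r * sum g
∑ᵒ-one {t} (suc r) zero g = begin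
  t * ∑[ j < t ] ∑ᵒ r (λ I → g j)  ≡⟨ cong (t *_) (sum-cong-≗ (λ j → ∑ᵒ-const r (g j))) ⟩
  t * ∑[ j < t ] (t ^ r * g j)     ≡⟨ cong (t *_) (*-distribˡ-sum (t ^ r) g) ⟨
  t * (t ^ r * sum g)              ≡⟨ ℕ.*-assoc t (t ^ r) _ ⟨
  t ^ suc r * sum g                ∎
  where open ≡-Reasoning
∑ᵒ-one {t} (suc r) (suc i) g = begin
  t * ∑[ j < t ] ∑ᵒ r (λ I → g (lookup I i))  ≡⟨ cong (t *_) (sum-const t _) ⟩
  t * (t * ∑ᵒ r (λ I → g (lookup I i)))       ≡⟨ cong (t *_) (∑ᵒ-one r i g) ⟩
  t * (t ^ r * sum g)                         ≡⟨ ℕ.*-assoc t (t ^ r) _ ⟨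
  t ^ suc r * sum g                           ∎
  where open ≡-Reasoning

-- Pairwise independence: two distinct rows select a uniform pair of columns. A single row taken
-- twice would see only the diagonal of `g`.
∑ᵒ-two : ∀ r (i i′ : Fin r) → i ≢ i′ → (g : Fin t → Fin t → ℕ) →
  t * t * ∑ᵒ r (λ I → g (lookup I i) (lookup I i′)) ≡ t ^ r * ∑[ j < t ] sum (g j)
∑ᵒ-two (suc r) zero zero i≢i′ g = contradiction refl i≢i′
∑ᵒ-two {t} (suc r) zero (suc i′) _ g = begin
  t * t * ∑[ j < t ] ∑ᵒ r (λ I → g j (lookup I i′))
    ≡⟨ ℕ.*-assoc t t _ ⟩
  t * (t * ∑[ j < t ] ∑ᵒ r (λ I → g j (lookup I i′)))
    ≡⟨ cong (t *_) (*-distribˡ-sum t (λ j → ∑ᵒ r (λ I → g j (lookup I i′)))) ⟩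
  t * ∑[ j < t ] (t * ∑ᵒ r (λ I → g j (lookup I i′)))
    ≡⟨ cong (t *_) (sum-cong-≗ (λ j → ∑ᵒ-one r i′ (g j))) ⟩
  t * ∑[ j < t ] (t ^ r * sum (g j))
    ≡⟨ cong (t *_) (*-distribˡ-sum (t ^ r) (λ j → sum (g j))) ⟨
  t * (t ^ r * ∑[ j < t ] sum (g j))
    ≡⟨ ℕ.*-assoc t (t ^ r) _ ⟨
  t ^ suc r * ∑[ j < t ] sum (g j) ∎
  where open ≡-Reasoning
∑ᵒ-two {t} (suc r) (suc i) zero _ g =
  trans (∑ᵒ-two (suc r) zero (suc i) (λ ()) (λ j′ j → g j j′))
        (cong (t ^ suc r *_) (∑-comm (λ j′ j → g j j′)))
∑ᵒ-two {t} (suc r) (suc i) (suc i′) i≢i′ g = begin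
  t * t * ∑[ j < t ] ∑ᵒ r (λ I → g (lookup I i) (lookup I i′))
    ≡⟨ cong (t * t *_) (sum-const t _) ⟩
  t * t * (t * X)                    ≡⟨ ℕ.*-comm (t * t) (t * X) ⟩
  t * X * (t * t)                    ≡⟨ ℕ.*-assoc t X (t * t) ⟩
  t * (X * (t * t))                  ≡⟨ cong (t *_) (ℕ.*-comm X (t * t)) ⟩
  t * (t * t * X)                    ≡⟨ cong (t *_) (∑ᵒ-two r i i′ (i≢i′ ∘ cong suc) g) ⟩
  t * (t ^ r * ∑[ j < t ] sum (g j)) ≡⟨ ℕ.*-assoc t (t ^ r) _ ⟨
  t ^ suc r * ∑[ j < t ] sum (g j)   ∎
  where
  open ≡-Reasoning
  X = ∑ᵒ r (λ I → g (lookup I i) (lookup I i′))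

-- Frequencies and ranks

rowFreq-sum : (M : Matrix r t n) (l : Fin n) (i : Fin r) → rowFreq M l i ≡ ∑[ j < t ] 𝟙 (M i j Fin.≟ l)
rowFreq-sum M l i = length-filter-tabulate (λ j → M i j Fin.≟ l) id

d-sum : (M : Matrix r t n) (i : Fin r) (j : Fin t) →
  d M i j ≡ ∑[ j′ < t ] 𝟙 ((j Fin.≤? j′) ×-dec (M i j′ Fin.≟ M i j))
d-sum M i j = length-filter-tabulate (λ j′ → (j Fin.≤? j′) ×-dec (M i j′ Fin.≟ M i j)) id

freq-sum : (M : Matrix r t n) (l : Fin n) → freq M l ≡ ∑[ i < r ] rowFreq M l i
freq-sum {r} {t} M l = length-filter-cartesian (λ (i , j) → M i j Fin.≟ l) _,_ id (allFin t)

d≤rowFreq : (M : Matrix r t n) (i : Fin r) (j : Fin t) → d M i j ≤ rowFreq M (M i j) i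
d≤rowFreq {t = t} M i j = begin
  d M i j                    ≡⟨ d-sum M i j ⟩
  ∑[ j′ < t ] 𝟙 ((j Fin.≤? j′) ×-dec (M i j′ Fin.≟ M i j))
    ≤⟨ sum-mono-≤ (λ j′ → 𝟙-mono ((j Fin.≤? j′) ×-dec (M i j′ Fin.≟ M i j)) (M i j′ Fin.≟ M i j) proj₂) ⟩
  ∑[ j′ < t ] 𝟙 (M i j′ Fin.≟ M i j) ≡⟨ rowFreq-sum M (M i j) i ⟨
  rowFreq M (M i j) i        ∎
  where open ℕ.≤-Reasoning

-- As j runs over the occurrences of v in a row from right to left, d runs over 1, 2, 3, …
rank-row : ∀ {t n} (w : Fin t → Fin n) v m →
  ∑[ j < t ] 𝟙 ((w j Fin.≟ v) ×-dec (∑[ j′ < t ] 𝟙 ((j Fin.≤? j′) ×-dec (w j′ Fin.≟ w j)) ℕ.≤? m))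
    ≤ (∑[ j < t ] 𝟙 (w j Fin.≟ v)) ⊓ m
rank-row {zero}  w v m = z≤n
rank-row {suc t} {n} w v m = begin
  𝟙 ((w zero Fin.≟ v) ×-dec (from zero ℕ.≤? m)) + ∑[ j < t ] 𝟙 ((w (suc j) Fin.≟ v) ×-dec (from (suc j) ℕ.≤? m))
    ≤⟨ ℕ.+-monoʳ-≤ (𝟙 ((w zero Fin.≟ v) ×-dec (from zero ℕ.≤? m))) (sum-mono-≤ tail-term) ⟩
  𝟙 ((w zero Fin.≟ v) ×-dec (from zero ℕ.≤? m)) + ranks
    ≤⟨ head-case (w zero Fin.≟ v) (from zero ℕ.≤? m) ⟩
  (𝟙 (w zero Fin.≟ v) + occ) ⊓ m ∎
  where
  open ℕ.≤-Reasoning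
  w′ = w ∘ suc
  from : Fin (suc t) → ℕ
  from j = ∑[ j′ < suc t ] 𝟙 ((j Fin.≤? j′) ×-dec (w j′ Fin.≟ w j))
  from′ : Fin t → ℕ
  from′ j = ∑[ j′ < t ] 𝟙 ((j Fin.≤? j′) ×-dec (w′ j′ Fin.≟ w′ j))
  occ ranks : ℕ
  occ = ∑[ j < t ] 𝟙 (w′ j Fin.≟ v)
  ranks = ∑[ j < t ] 𝟙 ((w′ j Fin.≟ v) ×-dec (from′ j ℕ.≤? m))
  from′≤from : ∀ j → from′ j ≤ from (suc j)
  from′≤from j = sum-mono-≤ (λ j′ →
    𝟙-mono ((j Fin.≤? j′) ×-dec (w′ j′ Fin.≟ w′ j)) ((suc j Fin.≤? suc j′) ×-dec (w′ j′ Fin.≟ w′ j))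
           (λ (j≤j′ , eq) → s≤s j≤j′ , eq))
  tail-term : ∀ j → 𝟙 ((w (suc j) Fin.≟ v) ×-dec (from (suc j) ℕ.≤? m)) ≤ 𝟙 ((w′ j Fin.≟ v) ×-dec (from′ j ℕ.≤? m))
  tail-term j = 𝟙-mono ((w (suc j) Fin.≟ v) ×-dec (from (suc j) ℕ.≤? m)) ((w′ j Fin.≟ v) ×-dec (from′ j ℕ.≤? m))
                  (λ (eq , f≤m) → eq , ℕ.≤-trans (from′≤from j) f≤m)
  IH : ranks ≤ occ ⊓ m
  IH = rank-row w′ v m
  occ<from : w zero ≡ v → suc occ ≤ from zero
  occ<from refl = ℕ.+-mono-≤
    (ℕ.≤-reflexive (sym (𝟙-true ((zero {t} Fin.≤? zero {t}) ×-dec (w zero Fin.≟ w zero)) (z≤n , refl))))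
    (sum-mono-≤ (λ j′ → 𝟙-mono (w′ j′ Fin.≟ w zero) ((zero {t} Fin.≤? suc j′) ×-dec (w′ j′ Fin.≟ w zero)) (z≤n ,_)))
  head-case : ∀ (a : Dec (w zero ≡ v)) (b : Dec (from zero ≤ m)) → 𝟙 (a ×-dec b) + ranks ≤ (𝟙 a + occ) ⊓ m
  head-case (no _)   _       = IH
  head-case (yes _)  (no _)  = ℕ.≤-trans IH (ℕ.⊓-monoˡ-≤ m (ℕ.n≤1+n occ))
  head-case (yes eq) (yes f≤m) = ℕ.⊓-glb (s≤s ranks≤occ) (ℕ.≤-trans (s≤s ranks≤occ) (ℕ.≤-trans (occ<from eq) f≤m))
    where ranks≤occ = ℕ.≤-trans IH (ℕ.m⊓n≤m occ m)

rank-d : (M : Matrix r t n) (i : Fin r) (v : Fin n) (m : ℕ) →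
  ∑[ j < t ] 𝟙 ((M i j Fin.≟ v) ×-dec (d M i j ℕ.≤? m)) ≤ rowFreq M v i ⊓ m
rank-d {t = t} M i v m = begin
  ∑[ j < t ] 𝟙 ((M i j Fin.≟ v) ×-dec (d M i j ℕ.≤? m))
    ≡⟨ sum-cong-≗ (λ j → cong (λ x → 𝟙 ((M i j Fin.≟ v) ×-dec (x ℕ.≤? m))) (d-sum M i j)) ⟩
  _ ≤⟨ rank-row (M i) v m ⟩
  _ ≡⟨ cong (_⊓ m) (rowFreq-sum M v i) ⟨
  rowFreq M v i ⊓ m ∎
  where open ℕ.≤-Reasoning

sum-by-value : (M : Matrix r t n) (h : Fin n → ℕ) →
  ∑[ i < r ] ∑[ j < t ] h (M i j) ≡ ∑[ l < n ] (freq M l * h l)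
sum-by-value {r} {t} {n} M h = begin
  ∑[ i < r ] ∑[ j < t ] h (M i j)
    ≡⟨ sum-cong-≗ (λ i → sum-cong-≗ (λ j → sum-𝟙≟ (M i j) h)) ⟨
  ∑[ i < r ] ∑[ j < t ] ∑[ l < n ] (𝟙 (M i j Fin.≟ l) * h l)
    ≡⟨ sum-cong-≗ (λ i → ∑-comm (λ j l → 𝟙 (M i j Fin.≟ l) * h l)) ⟩
  ∑[ i < r ] ∑[ l < n ] ∑[ j < t ] (𝟙 (M i j Fin.≟ l) * h l)
    ≡⟨ sum-cong-≗ (λ i → sum-cong-≗ (λ l → *-distribʳ-sum (h l) (λ j → 𝟙 (M i j Fin.≟ l)))) ⟨
  ∑[ i < r ] ∑[ l < n ] (∑[ j < t ] 𝟙 (M i j Fin.≟ l) * h l)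
    ≡⟨ sum-cong-≗ (λ i → sum-cong-≗ (λ l → cong (_* h l) (rowFreq-sum M l i))) ⟨
  ∑[ i < r ] ∑[ l < n ] (rowFreq M l i * h l)
    ≡⟨ ∑-comm (λ i l → rowFreq M l i * h l) ⟩
  ∑[ l < n ] ∑[ i < r ] (rowFreq M l i * h l)
    ≡⟨ sum-cong-≗ (λ l → *-distribʳ-sum (h l) (rowFreq M l)) ⟨
  ∑[ l < n ] (sum (rowFreq M l) * h l)
    ≡⟨ sum-cong-≗ (λ l → cong (_* h l) (freq-sum M l)) ⟨
  ∑[ l < n ] (freq M l * h l) ∎
  where open ≡-Reasoning

-- The process

run : Matrix r t n → ℕ → State n → Vec (Fin t) r → State n
run {zero}  M lam s []      = s
run {suc r} M lam s (j ∷ I) = run (M ∘ suc) lam (step M lam s zero j) I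

-- The fold keeps the full matrix and walks through row indices, whereas `run` discards rows.
-- Generalising over the remaining row indices `ρ` makes the induction pass; `step` inspects only
-- its own row.
foldl-step≡run : ∀ {r r′ t n} (M : Matrix r t n) lam s (I : Vec (Fin t) r) (ρ : Fin r′ → Fin r)
  (I′ : Vec (Fin t) r′) → (∀ i → lookup I (ρ i) ≡ lookup I′ i) →
  foldl (λ s i → step M lam s i (lookup I i)) s {r′} ρ ≡ run (M ∘ ρ) lam s I′
foldl-step≡run {r′ = zero}   M lam s I ρ []       eq = refl
foldl-step≡run {r′ = suc r′} M lam s I ρ (j ∷ I′) eq rewrite eq zero =
  foldl-step≡run M lam (step M lam s (ρ zero) j) I (ρ ∘ suc) I′ (eq ∘ suc)

finalState≡run : ∀ {r t n} (M : Matrix (suc r) t n) lam j (I : Vec (Fin t) r) →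
  finalState M lam (j ∷ I) ≡ run (M ∘ suc) lam (restart M lam zero j) I
finalState≡run M lam j I = foldl-step≡run M lam (restart M lam zero j) (j ∷ I) suc I (λ _ → refl)

step-keep : (M : Matrix r t n) (lam : ℕ) (s : State n) (i : Fin r) (j : Fin t) →
  (lam * q s) ⊔ d M i j ≤ C s → step M lam s i j ≡ state (S s) (C s + rowFreq M (S s) i) (suc (q s))
step-keep M lam s i j C≥ with C s ℕ.<? (lam * q s) ⊔ d M i j
... | yes C< = contradiction C< (ℕ.≤⇒≯ C≥)
... | no _   = refl

-- Survival of a sample

prefix : (Fin r → ℕ) → Fin r → ℕ
prefix p zero    = 0
prefix p (suc i) = p zero + prefix (p ∘ suc) i

-- Both ends are excluded; 0 unless i < i′.
between : (Fin r → ℕ) → Fin r → Fin r → ℕ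
between p i       zero     = 0
between p zero    (suc i′) = prefix (p ∘ suc) i′
between p (suc i) (suc i′) = between (p ∘ suc) i i′

-- The counter C needed in excess of lam * q for the test C < lam * q never
-- to succeed in the remaining rows, when row i adds p i to C.
demand : ℕ → (Fin r → ℕ) → ℕ
demand {zero}  lam p = 0
demand {suc r} lam p = (lam + demand lam (p ∘ suc)) ∸ p zero

demandAfter : ℕ → (Fin r → ℕ) → Fin r → ℕ
demandAfter lam p zero    = demand lam (p ∘ suc)
demandAfter lam p (suc i) = demandAfter lam (p ∘ suc) i

-- The first hypothesis is an invariant that guards against `lam * q`: a row adds its frequency to
-- the counter and `lam` to `lam * q`, and the recursion for `demand` balances the two. The second
-- guards against `d`, as the counter before row `i` is the initial one plus `prefix`.
run-keeps : (M : Matrix r t n) (lam : ℕ) (s : State n) (I : Vec (Fin t) r) →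
  lam * q s + demand lam (rowFreq M (S s)) ≤ C s →
  (∀ i → d M i (lookup I i) ≤ C s + prefix (rowFreq M (S s)) i) →
  S (run M lam s I) ≡ S s
run-keeps {zero}  M lam s []      safe low = refl
run-keeps {suc r} M lam s (j ∷ I) safe low =
  trans (cong (λ s′ → S (run (M ∘ suc) lam s′ I)) (step-keep M lam s zero j keeps))
        (run-keeps (M ∘ suc) lam (state (S s) (C s + p zero) (suc (q s))) I safe′ low′)
  where
  p = rowFreq M (S s)
  D = demand lam (p ∘ suc)
  keeps : (lam * q s) ⊔ d M zero j ≤ C s
  keeps = ℕ.⊔-lub (ℕ.≤-trans (ℕ.m≤m+n _ _) safe) (subst (d M zero j ≤_) (ℕ.+-identityʳ _) (low zero))
  safe′ : lam * suc (q s) + D ≤ C s + p zero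
  safe′ = begin
    lam * suc (q s) + D                        ≡⟨ cong (_+ D) (ℕ.*-suc lam (q s)) ⟩
    lam + lam * q s + D                        ≡⟨ cong (_+ D) (ℕ.+-comm lam (lam * q s)) ⟩
    lam * q s + lam + D                        ≡⟨ ℕ.+-assoc (lam * q s) lam D ⟩
    lam * q s + (lam + D)                      ≤⟨ ℕ.+-monoʳ-≤ (lam * q s) (ℕ.m≤n+m∸n (lam + D) (p zero)) ⟩
    lam * q s + (p zero + (lam + D ∸ p zero))  ≡⟨ cong (λ z → lam * q s + z) (ℕ.+-comm (p zero) _) ⟩
    lam * q s + (lam + D ∸ p zero + p zero)    ≡⟨ ℕ.+-assoc (lam * q s) _ (p zero) ⟨
    lam * q s + (lam + D ∸ p zero) + p zero    ≤⟨ ℕ.+-monoˡ-≤ (p zero) safe ⟩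
    C s + p zero                               ∎
    where open ℕ.≤-Reasoning
  low′ : ∀ i → d M (suc i) (lookup I i) ≤ C s + p zero + prefix (p ∘ suc) i
  low′ i = subst (d M (suc i) (lookup I i) ≤_) (sym (ℕ.+-assoc (C s) _ _)) (low (suc i))

module _ (lam : ℕ) (B : Fin n → ℕ) where

  -- B l bounds the counter of a state with value l, so this is necessary for
  -- such a state with q = m to reject a cell with d = c.
  Blocks : ℕ → Fin n → ℕ → Set
  Blocks m l c = lam * m ≤ B l × c ≤ B l

  -- `B` is a parameter rather than `freq M` because the induction discards rows: frequencies then
  -- shrink, but counters built up in the discarded rows persist, and `bounded` still holds.
  -- `before` lets x enter; `good` and `after` protect it from the two halves of the later tests.
  record Clear (M : Matrix r t n) (I : Vec (Fin t) r) (i : Fin r) : Set where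
    j = lookup I i
    p = rowFreq M (M i j)
    field
      bounded : ∀ l → sum (rowFreq M l) ≤ B l
      before  : ∀ i′ → i′ Fin.< i → ¬ Blocks (toℕ i ∸ toℕ i′) (M i′ (lookup I i′)) (d M i j)
      good    : lam + demandAfter lam p i ≤ d M i j
      after   : ∀ i′ → i Fin.< i′ → d M i′ (lookup I i′) ≤ d M i j + between p i i′

  open Clear

  Clear-tail : (M : Matrix (suc r) t n) (j : Fin t) (I : Vec (Fin t) r) {i : Fin r} →
    Clear M (j ∷ I) (suc i) → Clear (M ∘ suc) I i
  Clear-tail M j I c = record
    { bounded = λ l → ℕ.≤-trans (ℕ.m≤n+m _ _) (bounded c l)
    ; before  = λ i′ i′<i → before c (suc i′) (s<s i′<i)
    ; good    = good c
    ; after   = λ i′ i<i′ → after c (suc i′) (s<s i<i′)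
    }

  mutual
    -- While the state survives, `q s + toℕ i`, its `q` on arrival at row `i`, does not change, nor
    -- does its counter plus its future row frequencies. Surviving row `i` itself would make this
    -- bounded counter pass both halves of the test, which is `Blocks`. If an earlier cell takes
    -- over, the argument restarts from that cell.
    run-reaches : (M : Matrix r t n) (s : State n) (I : Vec (Fin t) r) {i : Fin r} → Clear M I i →
      C s + sum (rowFreq M (S s)) ≤ B (S s) →
      ¬ Blocks (q s + toℕ i) (S s) (d M i (lookup I i)) →
      S (run M lam s I) ≡ M i (lookup I i)
    run-reaches {suc r} M s (j ∷ I) {i} c C≤B ¬blocks with C s ℕ.<? (lam * q s) ⊔ d M zero j
    ... | yes C< = restart-reaches M j I c
    run-reaches {suc r} M s (j ∷ I) {zero} c C≤B ¬blocks | no C≮ =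
      contradiction (subst (λ m → lam * m ≤ B (S s)) (sym (ℕ.+-identityʳ (q s)))
                           (ℕ.≤-trans (ℕ.m⊔n≤o⇒m≤o _ _ C≥) C≤B′) ,
                     ℕ.≤-trans (ℕ.m⊔n≤o⇒n≤o (lam * q s) _ C≥) C≤B′) ¬blocks
      where
      C≥ = ℕ.≮⇒≥ C≮
      C≤B′ = ℕ.≤-trans (ℕ.m≤m+n _ _) C≤B
    run-reaches {suc r} M s (j ∷ I) {suc i} c C≤B ¬blocks | no C≮ =
      run-reaches (M ∘ suc) (state (S s) (C s + rowFreq M (S s) zero) (suc (q s))) I (Clear-tail M j I c)
        (subst (_≤ B (S s)) (sym (ℕ.+-assoc (C s) _ _)) C≤B)
        (subst (λ m → ¬ Blocks m (S s) (d M (suc i) (lookup I i))) (ℕ.+-suc (q s) (toℕ i)) ¬blocks)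

    restart-reaches : (M : Matrix (suc r) t n) (j : Fin t) (I : Vec (Fin t) r) {i : Fin (suc r)} →
      Clear M (j ∷ I) i →
      S (run (M ∘ suc) lam (restart M lam zero j) I) ≡ M i (lookup (j ∷ I) i)
    restart-reaches M j I {zero} c =
      run-keeps (M ∘ suc) lam (restart M lam zero j) I
        (subst (λ m → m + demand lam (rowFreq M (M zero j) ∘ suc) ≤ d M zero j) (sym (ℕ.*-identityʳ lam)) (good c))
        (λ i → after c (suc i) z<s)
    restart-reaches M j I {suc i} c =
      run-reaches (M ∘ suc) (restart M lam zero j) I (Clear-tail M j I c)
        (ℕ.≤-trans (ℕ.+-monoˡ-≤ _ (d≤rowFreq M zero j)) (bounded c (M zero j)))
        -- A fresh state has `q = 1`, so its `q` on arrival, `1 + toℕ i`, is exactly the distance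
        -- between the two rows that `before` speaks of.
        (before c zero z<s)

-- Good cells and conflicts

module _ (M : Matrix r t n) .{{_ : NonZero n}} (lam : ℕ) where

  Good : Fin r → Fin t → Set
  Good i j = M i j ≡ one × lam + demandAfter lam (rowFreq M one) i ≤ d M i j

  Good? : ∀ i j → Dec (Good i j)
  Good? i j = (M i j Fin.≟ one) ×-dec (_ ℕ.≤? _)

  -- Counting any other selected occurrence of 1 as a conflict (Twin) makes a
  -- conflict-free good cell the only selected occurrence of 1.
  Twin Block Drop Conflict : Fin r → Fin t → Fin r → Fin t → Set
  Twin  i j i′ j′ = M i j ≡ one × M i′ j′ ≡ one
  Block i j i′ j′ = M i′ j′ ≢ one × i′ Fin.< i × lam * (toℕ i ∸ toℕ i′) ≤ freq M (M i′ j′) ×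
                    M i j ≡ one × d M i j ≤ freq M (M i′ j′)
  Drop  i j i′ j′ = i Fin.< i′ × M i j ≡ one × d M i j + between (rowFreq M one) i i′ < d M i′ j′
  Conflict i j i′ j′ = i ≢ i′ × (Twin i j i′ j′ ⊎ Block i j i′ j′ ⊎ Drop i j i′ j′)

  Twin? : ∀ i j i′ j′ → Dec (Twin i j i′ j′)
  Twin? i j i′ j′ = (M i j Fin.≟ one) ×-dec (M i′ j′ Fin.≟ one)

  Block? : ∀ i j i′ j′ → Dec (Block i j i′ j′)
  Block? i j i′ j′ = ¬? (M i′ j′ Fin.≟ one) ×-dec (i′ Fin.<? i) ×-dec (_ ℕ.≤? _) ×-dec
                     (M i j Fin.≟ one) ×-dec (_ ℕ.≤? _)

  Drop? : ∀ i j i′ j′ → Dec (Drop i j i′ j′)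
  Drop? i j i′ j′ = (i Fin.<? i′) ×-dec (M i j Fin.≟ one) ×-dec (_ ℕ.<? _)

  Conflict? : ∀ i j i′ j′ → Dec (Conflict i j i′ j′)
  Conflict? i j i′ j′ = ¬? (i Fin.≟ i′) ×-dec (Twin? i j i′ j′ ⊎-dec Block? i j i′ j′ ⊎-dec Drop? i j i′ j′)

no-conflict⇒S≡one : ∀ {r} (M : Matrix (suc r) t n) .{{_ : NonZero n}} lam (I : Vec (Fin t) (suc r)) i →
  Good M lam i (lookup I i) →
  (∀ i′ → ¬ Conflict M lam i (lookup I i) i′ (lookup I i′)) →
  S (finalState M lam I) ≡ one
no-conflict⇒S≡one M lam (j₀ ∷ I₀) i (M≡one , d≥) free = begin
  S (finalState M lam I)                               ≡⟨ cong S (finalState≡run M lam j₀ I₀) ⟩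
  S (run (M ∘ suc) lam (restart M lam zero j₀) I₀)     ≡⟨ restart-reaches lam (freq M) M j₀ I₀ clear ⟩
  M i (lookup I i)                                     ≡⟨ M≡one ⟩
  one                                                  ∎
  where
  open ≡-Reasoning
  I = j₀ ∷ I₀
  clear : Clear lam (freq M) M I i
  clear = record
    { bounded = λ l → ℕ.≤-reflexive (sym (freq-sum M l))
    ; before  = λ i′ i′<i (lam≤ , d≤) →
        let i≢i′ = λ i≡i′ → Fin.<⇒≢ i′<i (sym i≡i′)
            M′≢one = λ M′≡one → free i′ (i≢i′ , inj₁ (M≡one , M′≡one))
        in free i′ (i≢i′ , inj₂ (inj₁ (M′≢one , i′<i , lam≤ , M≡one , d≤)))
    ; good    = subst (λ l → lam + demandAfter lam (rowFreq M l) i ≤ d M i (lookup I i)) (sym M≡one) d≥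
    ; after   = λ i′ i<i′ → ℕ.≮⇒≥ λ d< → free i′ (Fin.<⇒≢ i<i′ ,
        inj₂ (inj₂ (i<i′ , M≡one , subst (λ l → d M i (lookup I i) + between (rowFreq M l) i i′ < d M i′ (lookup I i′)) M≡one d<)))
    }

S≡one? : .{{_ : NonZero r}} .{{_ : NonZero n}} (M : Matrix r t n) (lam : ℕ) (I : Vec (Fin t) r) →
  Dec (S (finalState M lam I) ≡ one)
S≡one? M lam I = S (finalState M lam I) Fin.≟ one

good≤final+conflicts : ∀ {r} (M : Matrix (suc r) t n) .{{_ : NonZero n}} lam (I : Vec (Fin t) (suc r)) →
  ∑[ i < suc r ] 𝟙 (Good? M lam i (lookup I i))
    ≤ 𝟙 (S≡one? M lam I) + ∑[ i < suc r ] ∑[ i′ < suc r ] 𝟙 (Conflict? M lam i (lookup I i) i′ (lookup I i′))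
good≤final+conflicts {r = r} M lam I
  with Fin.any? (λ i → Good? M lam i (lookup I i) ×-dec
                       Fin.all? (λ i′ → ¬? (Conflict? M lam i (lookup I i) i′ (lookup I i′))))
... | yes (i , good , free) = begin
    ∑[ i′ < suc r ] g i′
      ≤⟨ sum-mono-≤ single ⟩
    ∑[ i′ < suc r ] (𝟙 (i Fin.≟ i′) * 1 + c i′ i)
      ≡⟨ ∑-distrib-+ (λ i′ → 𝟙 (i Fin.≟ i′) * 1) (λ i′ → c i′ i) ⟩
    ∑[ i′ < suc r ] (𝟙 (i Fin.≟ i′) * 1) + ∑[ i′ < suc r ] c i′ i
      ≡⟨ cong (_+ ∑[ i′ < suc r ] c i′ i) (sum-𝟙≟ i (λ _ → 1)) ⟩
    1 + ∑[ i′ < suc r ] c i′ i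
      ≡⟨ cong (_+ ∑[ i′ < suc r ] c i′ i) (𝟙-true (S≡one? M lam I) (no-conflict⇒S≡one M lam I i good free)) ⟨
    𝟙 (S≡one? M lam I) + ∑[ i′ < suc r ] c i′ i
      ≤⟨ ℕ.+-monoʳ-≤ (𝟙 (S≡one? M lam I)) (sum-mono-≤ (λ i′ → term≤sum (c i′) i)) ⟩
    𝟙 (S≡one? M lam I) + ∑[ i′ < suc r ] sum (c i′) ∎
  where
  open ℕ.≤-Reasoning
  g : Fin (suc r) → ℕ
  g i = 𝟙 (Good? M lam i (lookup I i))
  c : Fin (suc r) → Fin (suc r) → ℕ
  c i i′ = 𝟙 (Conflict? M lam i (lookup I i) i′ (lookup I i′))
  single : ∀ i′ → g i′ ≤ 𝟙 (i Fin.≟ i′) * 1 + c i′ i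
  single i′ = 𝟙≤ (Good? M lam i′ (lookup I i′)) λ good′ → bound good′ (i Fin.≟ i′)
    where
    bound : Good M lam i′ (lookup I i′) → (eq? : Dec (i ≡ i′)) → 1 ≤ 𝟙 eq? * 1 + c i′ i
    bound _     (yes _)   = s≤s z≤n
    -- Any other good cell `i′` is charged to its twin conflict with `i`. The pair is ordered with
    -- `i′` first: the cell in row `i` has no conflicts of its own.
    bound good′ (no i≢i′) = ℕ.≤-reflexive (sym (𝟙-true (Conflict? M lam i′ (lookup I i′) i (lookup I i))
      (i≢i′ ∘ sym , inj₁ (proj₁ good′ , proj₁ good))))
... | no ¬free = begin
    ∑[ i < suc r ] g i
      ≤⟨ sum-mono-≤ spoiled ⟩
    ∑[ i < suc r ] ∑[ i′ < suc r ] c i i′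
      ≤⟨ ℕ.m≤n+m _ (𝟙 (S≡one? M lam I)) ⟩
    𝟙 (S≡one? M lam I) + ∑[ i < suc r ] ∑[ i′ < suc r ] c i i′ ∎
  where
  open ℕ.≤-Reasoning
  g : Fin (suc r) → ℕ
  g i = 𝟙 (Good? M lam i (lookup I i))
  c : Fin (suc r) → Fin (suc r) → ℕ
  c i i′ = 𝟙 (Conflict? M lam i (lookup I i) i′ (lookup I i′))
  spoiled : ∀ i → g i ≤ sum (c i)
  spoiled i = 𝟙≤ (Good? M lam i (lookup I i)) λ good →
    let conflict? = λ i′ → Conflict? M lam i (lookup I i) i′ (lookup I i′)
        i′ , ¬¬conflict = Fin.¬∀⟶∃¬ (suc r) _ (λ i′ → ¬? (conflict? i′)) (λ free → ¬free (i , good , free))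
    in ℕ.≤-trans (ℕ.≤-reflexive (sym (𝟙-true (conflict? i′) (decidable-stable (conflict? i′) ¬¬conflict))))
                 (term≤sum (c i) i′)

-- Counting good cells and conflicts

∑⁴ : ∀ r t → (Fin r → Fin t → Fin r → Fin t → ℕ) → ℕ
∑⁴ r t f = ∑[ i < r ] ∑[ i′ < r ] ∑[ j < t ] ∑[ j′ < t ] f i j i′ j′

∑⁴-mono-≤ : {f g : Fin r → Fin t → Fin r → Fin t → ℕ} →
  (∀ i j i′ j′ → f i j i′ j′ ≤ g i j i′ j′) → ∑⁴ r t f ≤ ∑⁴ r t g
∑⁴-mono-≤ f≤g = sum-mono-≤ λ i → sum-mono-≤ λ i′ → sum-mono-≤ λ j → sum-mono-≤ λ j′ → f≤g i j i′ j′

∑⁴-+ : (f g : Fin r → Fin t → Fin r → Fin t → ℕ) →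
  ∑⁴ r t (λ i j i′ j′ → f i j i′ j′ + g i j i′ j′) ≡ ∑⁴ r t f + ∑⁴ r t g
∑⁴-+ {r} {t} f g =
  trans (sum-cong-≗ λ i →
    trans (sum-cong-≗ λ i′ →
      trans (sum-cong-≗ λ j → ∑-distrib-+ (f i j i′) (g i j i′))
            (∑-distrib-+ (λ j → sum (f i j i′)) (λ j → sum (g i j i′))))
      (∑-distrib-+ (λ i′ → ∑[ j < t ] sum (f i j i′)) (λ i′ → ∑[ j < t ] sum (g i j i′))))
    (∑-distrib-+ (λ i → ∑[ i′ < r ] ∑[ j < t ] sum (f i j i′)) (λ i → ∑[ i′ < r ] ∑[ j < t ] sum (g i j i′)))

-- Block and drop conflicts are counted by fixing the other cell y and asking how many occurrences x
-- of 1 it can spoil, so y has to come outermost.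
∑⁴-second-first : (f : Fin r → Fin t → Fin r → Fin t → ℕ) →
  ∑⁴ r t f ≡ ∑[ i′ < r ] ∑[ j′ < t ] ∑[ i < r ] ∑[ j < t ] f i j i′ j′
∑⁴-second-first {r} {t} f = begin
  ∑[ i < r ] ∑[ i′ < r ] ∑[ j < t ] ∑[ j′ < t ] f i j i′ j′
    ≡⟨ ∑-comm (λ i i′ → ∑[ j < t ] ∑[ j′ < t ] f i j i′ j′) ⟩
  ∑[ i′ < r ] ∑[ i < r ] ∑[ j < t ] ∑[ j′ < t ] f i j i′ j′
    ≡⟨ sum-cong-≗ (λ i′ → sum-cong-≗ (λ i → ∑-comm (λ j j′ → f i j i′ j′))) ⟩
  ∑[ i′ < r ] ∑[ i < r ] ∑[ j′ < t ] ∑[ j < t ] f i j i′ j′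
    ≡⟨ sum-cong-≗ (λ i′ → ∑-comm (λ i j′ → ∑[ j < t ] f i j i′ j′)) ⟩
  ∑[ i′ < r ] ∑[ j′ < t ] ∑[ i < r ] ∑[ j < t ] f i j i′ j′ ∎
  where open ≡-Reasoning

∑ᵒ-one-row : (g : Fin r → Fin t → ℕ) →
  t * ∑ᵒ r (λ I → ∑[ i < r ] g i (lookup I i)) ≡ t ^ r * ∑[ i < r ] ∑[ j < t ] g i j
∑ᵒ-one-row {r} {t} g = begin
  t * ∑ᵒ r (λ I → ∑[ i < r ] g i (lookup I i))     ≡⟨ cong (t *_) (∑ᵒ-∑ r (λ i I → g i (lookup I i))) ⟩
  t * ∑[ i < r ] ∑ᵒ r (λ I → g i (lookup I i))     ≡⟨ *-distribˡ-sum t (λ i → ∑ᵒ r (λ I → g i (lookup I i))) ⟩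
  ∑[ i < r ] (t * ∑ᵒ r (λ I → g i (lookup I i)))   ≡⟨ sum-cong-≗ (λ i → ∑ᵒ-one r i (g i)) ⟩
  ∑[ i < r ] (t ^ r * sum (g i))                   ≡⟨ *-distribˡ-sum (t ^ r) (λ i → sum (g i)) ⟨
  t ^ r * ∑[ i < r ] sum (g i)                     ∎
  where open ≡-Reasoning

-- Independence says nothing about pairs from the same row; `diag` removes them.
∑ᵒ-two-rows : (g : Fin r → Fin t → Fin r → Fin t → ℕ) → (∀ i j j′ → g i j i j′ ≡ 0) →
  t * t * ∑ᵒ r (λ I → ∑[ i < r ] ∑[ i′ < r ] g i (lookup I i) i′ (lookup I i′)) ≤ t ^ r * ∑⁴ r t g
∑ᵒ-two-rows {r} {t} g diag = begin
  t * t * ∑ᵒ r (λ I → ∑[ i < r ] ∑[ i′ < r ] h i i′ I)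
    ≡⟨ cong (t * t *_) (trans (∑ᵒ-∑ r (λ i I → ∑[ i′ < r ] h i i′ I)) (sum-cong-≗ (λ i → ∑ᵒ-∑ r (h i)))) ⟩
  t * t * ∑[ i < r ] ∑[ i′ < r ] ∑ᵒ r (h i i′)
    ≡⟨ *-distribˡ-sum (t * t) (λ i → ∑[ i′ < r ] ∑ᵒ r (h i i′)) ⟩
  ∑[ i < r ] (t * t * ∑[ i′ < r ] ∑ᵒ r (h i i′))
    ≡⟨ sum-cong-≗ (λ i → *-distribˡ-sum (t * t) (λ i′ → ∑ᵒ r (h i i′))) ⟩
  ∑[ i < r ] ∑[ i′ < r ] (t * t * ∑ᵒ r (h i i′))
    ≤⟨ sum-mono-≤ (λ i → sum-mono-≤ (λ i′ → pair i i′ (i Fin.≟ i′))) ⟩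
  ∑[ i < r ] ∑[ i′ < r ] (t ^ r * ∑[ j < t ] ∑[ j′ < t ] g i j i′ j′)
    ≡⟨ sum-cong-≗ (λ i → *-distribˡ-sum (t ^ r) (λ i′ → ∑[ j < t ] ∑[ j′ < t ] g i j i′ j′)) ⟨
  ∑[ i < r ] (t ^ r * ∑[ i′ < r ] ∑[ j < t ] ∑[ j′ < t ] g i j i′ j′)
    ≡⟨ *-distribˡ-sum (t ^ r) (λ i → ∑[ i′ < r ] ∑[ j < t ] ∑[ j′ < t ] g i j i′ j′) ⟨
  t ^ r * ∑⁴ r t g ∎
  where
  open ℕ.≤-Reasoning
  h : Fin r → Fin r → Vec (Fin t) r → ℕ
  h i i′ I = g i (lookup I i) i′ (lookup I i′)
  pair : ∀ i i′ → Dec (i ≡ i′) → t * t * ∑ᵒ r (h i i′) ≤ t ^ r * ∑[ j < t ] ∑[ j′ < t ] g i j i′ j′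
  pair i i′ (no i≢i′) = ℕ.≤-reflexive (∑ᵒ-two r i i′ i≢i′ (λ j j′ → g i j i′ j′))
  pair i .i (yes refl) = begin
    t * t * ∑ᵒ r (h i i)           ≤⟨ ℕ.*-monoʳ-≤ (t * t) (∑ᵒ-mono-≤ r (λ I → ℕ.≤-reflexive (diag i (lookup I i) (lookup I i)))) ⟩
    t * t * ∑ᵒ {t} r (λ _ → 0)     ≡⟨ cong (t * t *_) (trans (∑ᵒ-const r 0) (ℕ.*-zeroʳ (t ^ r))) ⟩
    t * t * 0                      ≡⟨ ℕ.*-zeroʳ (t * t) ⟩
    0                              ≤⟨ z≤n ⟩
    _                              ∎

-- At most `m / lam` positive multiples of `lam` fit below `m`: removing the first lowers `m` by
-- `lam` and shifts the others down by one. The product form avoids division.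
sum-window : ∀ r lam m → lam * ∑[ i < r ] 𝟙 (lam * suc (toℕ i) ℕ.≤? m) ≤ m
sum-window zero    lam m = ℕ.≤-trans (ℕ.≤-reflexive (ℕ.*-zeroʳ lam)) z≤n
sum-window (suc r) lam m with lam ℕ.≤? m
... | yes lam≤m = begin
  lam * (𝟙 (lam * 1 ℕ.≤? m) + ∑[ i < r ] 𝟙 (lam * suc (suc (toℕ i)) ℕ.≤? m))
    ≤⟨ ℕ.*-monoʳ-≤ lam (ℕ.+-mono-≤ (𝟙≤ (lam * 1 ℕ.≤? m) (λ _ → ℕ.≤-refl)) (sum-mono-≤ {r} shift)) ⟩
  lam * suc (∑[ i < r ] 𝟙 (lam * suc (toℕ i) ℕ.≤? m ∸ lam))
    ≡⟨ ℕ.*-suc lam _ ⟩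
  lam + lam * ∑[ i < r ] 𝟙 (lam * suc (toℕ i) ℕ.≤? m ∸ lam)
    ≤⟨ ℕ.+-monoʳ-≤ lam (sum-window r lam (m ∸ lam)) ⟩
  lam + (m ∸ lam)
    ≡⟨ ℕ.m+[n∸m]≡n lam≤m ⟩
  m ∎
  where
  open ℕ.≤-Reasoning
  shift : ∀ i → 𝟙 (lam * suc (suc (toℕ i)) ℕ.≤? m) ≤ 𝟙 (lam * suc (toℕ i) ℕ.≤? m ∸ lam)
  shift i = 𝟙-mono (lam * suc (suc (toℕ i)) ℕ.≤? m) (lam * suc (toℕ i) ℕ.≤? m ∸ lam)
    λ h → ℕ.m+n≤o⇒m≤o∸n _ (subst (_≤ m) (trans (ℕ.*-suc lam (suc (toℕ i))) (ℕ.+-comm lam _)) h)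
... | no lam≰m = begin
  lam * ∑[ i < suc r ] 𝟙 (lam * suc (toℕ i) ℕ.≤? m)
    ≤⟨ ℕ.*-monoʳ-≤ lam (sum-mono-≤ {suc r} {g = λ _ → 0} (λ i → 𝟙≤ (lam * suc (toℕ i) ℕ.≤? m) (λ h → contradiction (ℕ.≤-trans (ℕ.m≤m*n lam (suc (toℕ i))) h) lam≰m))) ⟩
  lam * ∑[ _ < suc r ] 0
    ≡⟨ cong (lam *_) (sum-zero (suc r)) ⟩
  lam * 0
    ≡⟨ ℕ.*-zeroʳ lam ⟩
  0 ≤⟨ z≤n ⟩
  m ∎
  where open ℕ.≤-Reasoning

-- Bounds the number of later rows at which a sample from row `i′`, with counter at most `m` and
-- never replaced, can still reach `lam * q`.
sum-window-after : ∀ {r} lam m (i′ : Fin r) →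
  lam * ∑[ i < r ] 𝟙 ((i′ Fin.<? i) ×-dec (lam * (toℕ i ∸ toℕ i′) ℕ.≤? m)) ≤ m
sum-window-after {suc r} lam m zero = begin
  lam * (𝟙 ((zero {r} Fin.<? zero {r}) ×-dec (lam * 0 ℕ.≤? m)) + ∑[ i < r ] 𝟙 ((zero {r} Fin.<? suc i) ×-dec (lam * suc (toℕ i) ℕ.≤? m)))
    ≤⟨ ℕ.*-monoʳ-≤ lam (ℕ.+-mono-≤
         (𝟙≤ ((zero {r} Fin.<? zero {r}) ×-dec (lam * 0 ℕ.≤? m)) (λ ()))
         (sum-mono-≤ {r} λ i → 𝟙-mono ((zero {r} Fin.<? suc i) ×-dec (lam * suc (toℕ i) ℕ.≤? m)) (lam * suc (toℕ i) ℕ.≤? m) proj₂)) ⟩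
  lam * ∑[ i < r ] 𝟙 (lam * suc (toℕ i) ℕ.≤? m)
    ≤⟨ sum-window r lam m ⟩
  m ∎
  where open ℕ.≤-Reasoning
sum-window-after {suc r} lam m (suc i′) = begin
  lam * (𝟙 ((suc i′ Fin.<? zero {r}) ×-dec (lam * (0 ∸ suc (toℕ i′)) ℕ.≤? m)) +
         ∑[ i < r ] 𝟙 ((suc i′ Fin.<? suc i) ×-dec (lam * (toℕ i ∸ toℕ i′) ℕ.≤? m)))
    ≤⟨ ℕ.*-monoʳ-≤ lam (ℕ.+-mono-≤
         (𝟙≤ ((suc i′ Fin.<? zero {r}) ×-dec (lam * (0 ∸ suc (toℕ i′)) ℕ.≤? m)) (λ ()))
         (sum-mono-≤ {r} λ i → 𝟙-mono ((suc i′ Fin.<? suc i) ×-dec (lam * (toℕ i ∸ toℕ i′) ℕ.≤? m))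
                                  ((i′ Fin.<? i) ×-dec (lam * (toℕ i ∸ toℕ i′) ℕ.≤? m)) (λ (lt , le) → s≤s⁻¹ lt , le))) ⟩
  lam * ∑[ i < r ] 𝟙 ((i′ Fin.<? i) ×-dec (lam * (toℕ i ∸ toℕ i′) ℕ.≤? m))
    ≤⟨ sum-window-after lam m i′ ⟩
  m ∎
  where open ℕ.≤-Reasoning

-- Number the occurrences of 1 backwards from row `i′`. Row `i` owns the `p i` numbers following
-- `between p i i′`; these ranges are disjoint, and the sum counts the numbers up to `m`.
sum-⊓-between : ∀ {r} (p : Fin r → ℕ) m (i′ : Fin r) →
  ∑[ i < r ] (𝟙 (i Fin.<? i′) * (p i ⊓ (m ∸ between p i i′))) ≤ prefix p i′ ⊓ m
sum-⊓-between {suc r} p m zero = begin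
  ∑[ i < suc r ] (𝟙 (i Fin.<? zero {r}) * (p i ⊓ m))
    ≡⟨ sum-cong-≗ (λ i → cong (_* (p i ⊓ m)) (𝟙-false (i Fin.<? zero {r}) (λ ()))) ⟩
  ∑[ i < suc r ] 0   ≡⟨ sum-zero (suc r) ⟩
  0                  ∎
  where open ℕ.≤-Reasoning
sum-⊓-between {suc r} p m (suc i′) = begin
  𝟙 (zero {r} Fin.<? suc i′) * (p zero ⊓ (m ∸ T)) +
    ∑[ i < r ] (𝟙 (suc i Fin.<? suc i′) * (p (suc i) ⊓ (m ∸ between (p ∘ suc) i i′)))
    ≡⟨ cong₂ _+_ (ℕ.*-identityˡ (p zero ⊓ (m ∸ T)))
                 (sum-cong-≗ (λ i → cong (_* (p (suc i) ⊓ (m ∸ between (p ∘ suc) i i′)))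
                                         (𝟙-cong (suc i Fin.<? suc i′) (i Fin.<? i′) s≤s⁻¹ s≤s))) ⟩
  p zero ⊓ (m ∸ T) + ∑[ i < r ] (𝟙 (i Fin.<? i′) * (p (suc i) ⊓ (m ∸ between (p ∘ suc) i i′)))
    ≤⟨ ℕ.+-monoʳ-≤ _ (sum-⊓-between (p ∘ suc) m i′) ⟩
  p zero ⊓ (m ∸ T) + T ⊓ m
    ≤⟨ ℕ.⊓-glb (ℕ.+-mono-≤ (ℕ.m⊓n≤m (p zero) (m ∸ T)) (ℕ.m⊓n≤m T m))
               (ℕ.≤-trans (ℕ.+-monoˡ-≤ (T ⊓ m) (ℕ.m⊓n≤n (p zero) (m ∸ T)))
                          (ℕ.≤-reflexive (trans (ℕ.+-comm (m ∸ T) (T ⊓ m)) (ℕ.m⊓n+n∸m≡n T m)))) ⟩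
  (p zero + T) ⊓ m ∎
  where
  open ℕ.≤-Reasoning
  T = prefix (p ∘ suc) i′

-- At most lam * r occurrences are not good: passing row i raises the demand
-- by lam and lowers it by p i, up to truncation at 0.
sum-⊓-demand : ∀ {r} lam (p : Fin r → ℕ) →
  ∑[ i < r ] (p i ⊓ (lam + demandAfter lam p i)) + demand lam p ≡ r * lam
sum-⊓-demand {zero}  lam p = refl
sum-⊓-demand {suc r} lam p = begin
  p zero ⊓ X + Σ + (X ∸ p zero)  ≡⟨ cong (_+ (X ∸ p zero)) (ℕ.+-comm (p zero ⊓ X) Σ) ⟩
  Σ + p zero ⊓ X + (X ∸ p zero)  ≡⟨ ℕ.+-assoc Σ _ _ ⟩
  Σ + (p zero ⊓ X + (X ∸ p zero)) ≡⟨ cong (λ z → Σ + z) (ℕ.m⊓n+n∸m≡n (p zero) X) ⟩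
  Σ + (lam + D)                  ≡⟨ cong (λ z → Σ + z) (ℕ.+-comm lam D) ⟩
  Σ + (D + lam)                  ≡⟨ ℕ.+-assoc Σ D lam ⟨
  Σ + D + lam                    ≡⟨ cong (_+ lam) (sum-⊓-demand lam (p ∘ suc)) ⟩
  r * lam + lam                  ≡⟨ ℕ.+-comm (r * lam) lam ⟩
  suc r * lam                    ∎
  where
  open ≡-Reasoning
  D = demand lam (p ∘ suc)
  X = lam + D
  Σ = ∑[ i < r ] (p (suc i) ⊓ (lam + demandAfter lam (p ∘ suc) i))

module _ (M : Matrix r t n) .{{_ : NonZero n}} (lam : ℕ) where

  private
    p : Fin r → ℕ
    p = rowFreq M one

  #good : ℕ
  #good = ∑[ i < r ] ∑[ j < t ] 𝟙 (Good? M lam i j)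

  #twin #block #drop : ℕ
  #twin  = ∑⁴ r t (λ i j i′ j′ → 𝟙 (Twin?  M lam i j i′ j′))
  #block = ∑⁴ r t (λ i j i′ j′ → 𝟙 (Block? M lam i j i′ j′))
  #drop  = ∑⁴ r t (λ i j i′ j′ → 𝟙 (Drop?  M lam i j i′ j′))

  -- An occurrence of 1 in row `i` that fails to be good has rank `d` at most `X i`. Ranks within a
  -- row are distinct, so at most `p i ⊓ X i` fail there, and these minima telescope against
  -- `demand`.
  f₁≤#good+lam*r : f₁ M ≤ #good + r * lam
  f₁≤#good+lam*r = begin
    f₁ M
      ≡⟨ freq-sum M one ⟩
    ∑[ i < r ] p i
      ≤⟨ sum-mono-≤ row ⟩
    ∑[ i < r ] (∑[ j < t ] 𝟙 (Good? M lam i j) + p i ⊓ X i)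
      ≡⟨ ∑-distrib-+ (λ i → ∑[ j < t ] 𝟙 (Good? M lam i j)) (λ i → p i ⊓ X i) ⟩
    #good + ∑[ i < r ] (p i ⊓ X i)
      ≤⟨ ℕ.+-monoʳ-≤ #good (ℕ.m≤m+n _ (demand lam p)) ⟩
    #good + (∑[ i < r ] (p i ⊓ X i) + demand lam p)
      ≡⟨ cong (λ z → #good + z) (sum-⊓-demand lam p) ⟩
    #good + r * lam ∎
    where
    open ℕ.≤-Reasoning
    X : Fin r → ℕ
    X i = lam + demandAfter lam p i
    cell : ∀ i j → 𝟙 (M i j Fin.≟ one) ≤ 𝟙 (Good? M lam i j) + 𝟙 ((M i j Fin.≟ one) ×-dec (d M i j ℕ.≤? X i))
    cell i j = 𝟙≤ (M i j Fin.≟ one) λ M≡one → split M≡one (ℕ.≤-total (X i) (d M i j))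
      where
      split : M i j ≡ one → X i ≤ d M i j ⊎ d M i j ≤ X i → 1 ≤ _
      split M≡one (inj₁ X≤d) = ℕ.≤-trans (ℕ.≤-reflexive (sym (𝟙-true (Good? M lam i j) (M≡one , X≤d)))) (ℕ.m≤m+n _ _)
      split M≡one (inj₂ d≤X) = ℕ.≤-trans
        (ℕ.≤-reflexive (sym (𝟙-true ((M i j Fin.≟ one) ×-dec (d M i j ℕ.≤? X i)) (M≡one , d≤X)))) (ℕ.m≤n+m _ (𝟙 (Good? M lam i j)))
    row : ∀ i → p i ≤ ∑[ j < t ] 𝟙 (Good? M lam i j) + p i ⊓ X i
    row i = begin
      p i
        ≡⟨ rowFreq-sum M one i ⟩
      ∑[ j < t ] 𝟙 (M i j Fin.≟ one)
        ≤⟨ sum-mono-≤ (cell i) ⟩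
      ∑[ j < t ] (𝟙 (Good? M lam i j) + 𝟙 ((M i j Fin.≟ one) ×-dec (d M i j ℕ.≤? X i)))
        ≡⟨ ∑-distrib-+ (λ j → 𝟙 (Good? M lam i j)) (λ j → 𝟙 ((M i j Fin.≟ one) ×-dec (d M i j ℕ.≤? X i))) ⟩
      ∑[ j < t ] 𝟙 (Good? M lam i j) + ∑[ j < t ] 𝟙 ((M i j Fin.≟ one) ×-dec (d M i j ℕ.≤? X i))
        ≤⟨ ℕ.+-monoʳ-≤ _ (rank-d M i one (X i)) ⟩
      ∑[ j < t ] 𝟙 (Good? M lam i j) + p i ⊓ X i ∎

  #twin≡f₁² : #twin ≡ f₁ M * f₁ M
  #twin≡f₁² = begin
    #twin
      ≡⟨ sum-cong-≗ (λ i → sum-cong-≗ (λ i′ → rows i i′)) ⟩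
    ∑[ i < r ] ∑[ i′ < r ] (p i * p i′)
      ≡⟨ sum-cong-≗ (λ i → *-distribˡ-sum (p i) p) ⟨
    ∑[ i < r ] (p i * sum p)
      ≡⟨ *-distribʳ-sum (sum p) p ⟨
    sum p * sum p
      ≡⟨ cong₂ _*_ (freq-sum M one) (freq-sum M one) ⟨
    f₁ M * f₁ M ∎
    where
    open ≡-Reasoning
    e : Fin r → Fin t → ℕ
    e i j = 𝟙 (M i j Fin.≟ one)
    rows : ∀ i i′ → ∑[ j < t ] ∑[ j′ < t ] 𝟙 (Twin? M lam i j i′ j′) ≡ p i * p i′
    rows i i′ = begin
      ∑[ j < t ] ∑[ j′ < t ] 𝟙 (Twin? M lam i j i′ j′)
        ≡⟨ sum-cong-≗ (λ j → sum-cong-≗ (λ j′ → 𝟙-× (M i j Fin.≟ one) (M i′ j′ Fin.≟ one))) ⟩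
      ∑[ j < t ] ∑[ j′ < t ] (e i j * e i′ j′)
        ≡⟨ sum-cong-≗ (λ j → *-distribˡ-sum (e i j) (e i′)) ⟨
      ∑[ j < t ] (e i j * sum (e i′))
        ≡⟨ *-distribʳ-sum (sum (e i′)) (e i) ⟨
      sum (e i) * sum (e i′)
        ≡⟨ cong₂ _*_ (rowFreq-sum M one i) (rowFreq-sum M one i′) ⟨
      p i * p i′ ∎

  -- A cell y can displace only those earlier 1s whose backward number is below its own `d`, hence
  -- at most as many as the frequency of its value. As y may itself be a 1, the bound contains f₁²,
  -- besides the f₁² from twins.
  #drop≤F₂ : #drop ≤ ∑[ l < n ] (freq M l * freq M l)
  #drop≤F₂ = begin
    #drop
      ≡⟨ ∑⁴-second-first (λ i j i′ j′ → 𝟙 (Drop? M lam i j i′ j′)) ⟩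
    ∑[ i′ < r ] ∑[ j′ < t ] ∑[ i < r ] ∑[ j < t ] 𝟙 (Drop? M lam i j i′ j′)
      ≤⟨ sum-mono-≤ (λ i′ → sum-mono-≤ (cell i′)) ⟩
    ∑[ i′ < r ] ∑[ j′ < t ] freq M (M i′ j′)
      ≡⟨ sum-by-value M (freq M) ⟩
    ∑[ l < n ] (freq M l * freq M l) ∎
    where
    open ℕ.≤-Reasoning
    row : ∀ i i′ m → ∑[ j < t ] 𝟙 ((i Fin.<? i′) ×-dec (M i j Fin.≟ one) ×-dec (d M i j + between p i i′ ℕ.<? m))
                       ≤ 𝟙 (i Fin.<? i′) * (p i ⊓ (m ∸ between p i i′))
    row i i′ m = begin
      ∑[ j < t ] 𝟙 ((i Fin.<? i′) ×-dec (M i j Fin.≟ one) ×-dec (d M i j + between p i i′ ℕ.<? m))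
        ≡⟨ sum-cong-≗ (λ j → 𝟙-× (i Fin.<? i′) ((M i j Fin.≟ one) ×-dec (d M i j + between p i i′ ℕ.<? m))) ⟩
      ∑[ j < t ] (𝟙 (i Fin.<? i′) * 𝟙 ((M i j Fin.≟ one) ×-dec (d M i j + between p i i′ ℕ.<? m)))
        ≡⟨ *-distribˡ-sum (𝟙 (i Fin.<? i′)) (λ j → 𝟙 ((M i j Fin.≟ one) ×-dec (d M i j + between p i i′ ℕ.<? m))) ⟨
      𝟙 (i Fin.<? i′) * ∑[ j < t ] 𝟙 ((M i j Fin.≟ one) ×-dec (d M i j + between p i i′ ℕ.<? m))
        ≤⟨ ℕ.*-monoʳ-≤ (𝟙 (i Fin.<? i′)) (ℕ.≤-trans (sum-mono-≤ (λ j → 𝟙-mono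
             ((M i j Fin.≟ one) ×-dec (d M i j + between p i i′ ℕ.<? m))
             ((M i j Fin.≟ one) ×-dec (d M i j ℕ.≤? m ∸ between p i i′))
             (λ (eq , lt) → eq , ℕ.m+n≤o⇒m≤o∸n (d M i j) (ℕ.<⇒≤ lt)))) (rank-d M i one (m ∸ between p i i′))) ⟩
      𝟙 (i Fin.<? i′) * (p i ⊓ (m ∸ between p i i′)) ∎
    cell : ∀ i′ j′ → ∑[ i < r ] ∑[ j < t ] 𝟙 (Drop? M lam i j i′ j′) ≤ freq M (M i′ j′)
    cell i′ j′ = begin
      ∑[ i < r ] ∑[ j < t ] 𝟙 (Drop? M lam i j i′ j′)
        ≤⟨ sum-mono-≤ (λ i → row i i′ (d M i′ j′)) ⟩
      ∑[ i < r ] (𝟙 (i Fin.<? i′) * (p i ⊓ (d M i′ j′ ∸ between p i i′)))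
        ≤⟨ sum-⊓-between p (d M i′ j′) i′ ⟩
      prefix p i′ ⊓ d M i′ j′
        ≤⟨ ℕ.m⊓n≤n _ _ ⟩
      d M i′ j′
        ≤⟨ d≤rowFreq M i′ j′ ⟩
      rowFreq M (M i′ j′) i′
        ≤⟨ term≤sum (rowFreq M (M i′ j′)) i′ ⟩
      sum (rowFreq M (M i′ j′))
        ≡⟨ freq-sum M (M i′ j′) ⟨
      freq M (M i′ j′) ∎

  -- For y with value l, only f_l / lam later rows are within reach, and each holds at most f_l
  -- occurrences of 1 with `d` at most f_l. There are f_l such y, giving f_l³ / lam. Blocking cells
  -- of value 1 already count as twins, which keeps f₁³ out of the sum.
  lam*#block≤G₃ : lam * #block ≤ ∑[ l < n ] (freq M l * (𝟙 (¬? (l Fin.≟ one)) * (freq M l * freq M l)))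
  lam*#block≤G₃ = begin
    lam * #block
      ≡⟨ cong (lam *_) (∑⁴-second-first (λ i j i′ j′ → 𝟙 (Block? M lam i j i′ j′))) ⟩
    lam * ∑[ i′ < r ] ∑[ j′ < t ] blocked i′ j′
      ≡⟨ *-distribˡ-sum lam (λ i′ → ∑[ j′ < t ] blocked i′ j′) ⟩
    ∑[ i′ < r ] (lam * ∑[ j′ < t ] blocked i′ j′)
      ≡⟨ sum-cong-≗ (λ i′ → *-distribˡ-sum lam (blocked i′)) ⟩
    ∑[ i′ < r ] ∑[ j′ < t ] (lam * blocked i′ j′)
      ≤⟨ sum-mono-≤ (λ i′ → sum-mono-≤ (cell i′)) ⟩
    ∑[ i′ < r ] ∑[ j′ < t ] h (M i′ j′)
      ≡⟨ sum-by-value M h ⟩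
    ∑[ l < n ] (freq M l * h l) ∎
    where
    open ℕ.≤-Reasoning
    blocked : Fin r → Fin t → ℕ
    blocked i′ j′ = ∑[ i < r ] ∑[ j < t ] 𝟙 (Block? M lam i j i′ j′)
    h : Fin n → ℕ
    h l = 𝟙 (¬? (l Fin.≟ one)) * (freq M l * freq M l)
    cell : ∀ i′ j′ → lam * blocked i′ j′ ≤ h (M i′ j′)
    cell i′ j′ = begin
      lam * ∑[ i < r ] ∑[ j < t ] 𝟙 (Block? M lam i j i′ j′)
        ≤⟨ ℕ.*-monoʳ-≤ lam (sum-mono-≤ row) ⟩
      lam * ∑[ i < r ] (v * (u i * f))
        ≡⟨ cong (lam *_) (trans (cong (v *_) (*-distribʳ-sum f u)) (*-distribˡ-sum v (λ i → u i * f))) ⟨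
      lam * (v * (sum u * f))
        ≡⟨ ℕ.*-assoc lam v _ ⟨
      lam * v * (sum u * f)
        ≡⟨ cong (_* (sum u * f)) (ℕ.*-comm lam v) ⟩
      v * lam * (sum u * f)
        ≡⟨ ℕ.*-assoc v lam _ ⟩
      v * (lam * (sum u * f))
        ≡⟨ cong (v *_) (ℕ.*-assoc lam (sum u) f) ⟨
      v * (lam * sum u * f)
        ≤⟨ ℕ.*-monoʳ-≤ v (ℕ.*-monoˡ-≤ f (sum-window-after lam f i′)) ⟩
      v * (f * f) ∎
      where
      f v : ℕ
      f = freq M (M i′ j′)
      v = 𝟙 (¬? (M i′ j′ Fin.≟ one))
      u : Fin r → ℕ
      u i = 𝟙 ((i′ Fin.<? i) ×-dec (lam * (toℕ i ∸ toℕ i′) ℕ.≤? f))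
      row : ∀ i → ∑[ j < t ] 𝟙 (Block? M lam i j i′ j′) ≤ v * (u i * f)
      row i = begin
        ∑[ j < t ] 𝟙 (Block? M lam i j i′ j′)
          ≡⟨ sum-cong-≗ (λ j → trans
               (𝟙-cong (Block? M lam i j i′ j′) (V? ×-dec U? ×-dec W? j)
                 (λ (a , b , c , w) → a , (b , c) , w) (λ (a , (b , c) , w) → a , b , c , w))
               (trans (𝟙-× V? (U? ×-dec W? j)) (cong (v *_) (𝟙-× U? (W? j))))) ⟩
        ∑[ j < t ] (v * (u i * 𝟙 (W? j)))
          ≡⟨ trans (cong (v *_) (*-distribˡ-sum (u i) (λ j → 𝟙 (W? j)))) (*-distribˡ-sum v (λ j → u i * 𝟙 (W? j))) ⟨
        v * (u i * ∑[ j < t ] 𝟙 (W? j))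
          ≤⟨ ℕ.*-monoʳ-≤ v (ℕ.*-monoʳ-≤ (u i) (ℕ.≤-trans (rank-d M i one f) (ℕ.m⊓n≤n _ f))) ⟩
        v * (u i * f) ∎
        where
        V? = ¬? (M i′ j′ Fin.≟ one)
        U? = (i′ Fin.<? i) ×-dec (lam * (toℕ i ∸ toℕ i′) ℕ.≤? f)
        W? : ∀ j → Dec (M i j ≡ one × d M i j ≤ f)
        W? j = (M i j Fin.≟ one) ×-dec (d M i j ℕ.≤? f)

#S≡one : .{{_ : NonZero r}} .{{_ : NonZero n}} → Matrix r t n → ℕ → ℕ
#S≡one {r} {t = t} M lam = ∑ᵒ r (λ I → 𝟙 (S≡one? M lam I))

good≤#S≡one+conflicts : (M : Matrix r t n) .{{_ : NonZero r}} .{{_ : NonZero n}} (lam : ℕ) →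
  t ^ r * (t * #good M lam) ≤ t * t * #S≡one M lam + t ^ r * (#twin M lam + (#block M lam + #drop M lam))
good≤#S≡one+conflicts {r@(suc _)} {t} M lam = begin
  t ^ r * (t * #good M lam)
    ≡⟨ trans (sym (ℕ.*-assoc (t ^ r) t _)) (trans (cong (_* #good M lam) (ℕ.*-comm (t ^ r) t)) (ℕ.*-assoc t (t ^ r) _)) ⟩
  t * (t ^ r * #good M lam)
    ≡⟨ cong (t *_) (∑ᵒ-one-row (λ i j → 𝟙 (Good? M lam i j))) ⟨
  t * (t * ∑ᵒ r (λ I → ∑[ i < r ] 𝟙 (Good? M lam i (lookup I i))))
    ≡⟨ ℕ.*-assoc t t _ ⟨
  t * t * ∑ᵒ r (λ I → ∑[ i < r ] 𝟙 (Good? M lam i (lookup I i)))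
    ≤⟨ ℕ.*-monoʳ-≤ (t * t) (∑ᵒ-mono-≤ r (good≤final+conflicts M lam)) ⟩
  t * t * ∑ᵒ r (λ I → 𝟙 (S≡one? M lam I) + conflicts I)
    ≡⟨ cong (t * t *_) (∑ᵒ-+ r (λ I → 𝟙 (S≡one? M lam I)) conflicts) ⟩
  t * t * (#S≡one M lam + ∑ᵒ r conflicts)
    ≡⟨ ℕ.*-distribˡ-+ (t * t) (#S≡one M lam) _ ⟩
  t * t * #S≡one M lam + t * t * ∑ᵒ r conflicts
    ≤⟨ ℕ.+-monoʳ-≤ (t * t * #S≡one M lam) (ℕ.≤-trans (∑ᵒ-two-rows (λ i j i′ j′ → 𝟙 (Conflict? M lam i j i′ j′)) diagonal)
                                        (ℕ.*-monoʳ-≤ (t ^ r) kinds)) ⟩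
  t * t * #S≡one M lam + t ^ r * (#twin M lam + (#block M lam + #drop M lam)) ∎
  where
  open ℕ.≤-Reasoning
  conflicts : Vec (Fin t) r → ℕ
  conflicts I = ∑[ i < r ] ∑[ i′ < r ] 𝟙 (Conflict? M lam i (lookup I i) i′ (lookup I i′))
  diagonal : ∀ i j j′ → 𝟙 (Conflict? M lam i j i j′) ≡ 0
  diagonal i j j′ = 𝟙-false (Conflict? M lam i j i j′) (λ (i≢i , _) → i≢i refl)
  T B D : Fin r → Fin t → Fin r → Fin t → ℕ
  T i j i′ j′ = 𝟙 (Twin? M lam i j i′ j′)
  B i j i′ j′ = 𝟙 (Block? M lam i j i′ j′)
  D i j i′ j′ = 𝟙 (Drop? M lam i j i′ j′)
  kind : ∀ i j i′ j′ → 𝟙 (Conflict? M lam i j i′ j′) ≤ T i j i′ j′ + (B i j i′ j′ + D i j i′ j′)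
  kind i j i′ j′ = begin
    𝟙 (Conflict? M lam i j i′ j′)
      ≤⟨ 𝟙-mono (Conflict? M lam i j i′ j′) (T? ⊎-dec B? ⊎-dec D?) proj₂ ⟩
    𝟙 (T? ⊎-dec B? ⊎-dec D?)
      ≤⟨ 𝟙-⊎ T? (B? ⊎-dec D?) ⟩
    𝟙 T? + 𝟙 (B? ⊎-dec D?)
      ≤⟨ ℕ.+-monoʳ-≤ (𝟙 T?) (𝟙-⊎ B? D?) ⟩
    𝟙 T? + (𝟙 B? + 𝟙 D?) ∎
    where
    T? = Twin? M lam i j i′ j′
    B? = Block? M lam i j i′ j′
    D? = Drop? M lam i j i′ j′
  kinds : ∑⁴ r t (λ i j i′ j′ → 𝟙 (Conflict? M lam i j i′ j′)) ≤ #twin M lam + (#block M lam + #drop M lam)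
  kinds = ℕ.≤-trans (∑⁴-mono-≤ kind)
    (ℕ.≤-reflexive (trans (∑⁴-+ T (λ i j i′ j′ → B i j i′ j′ + D i j i′ j′))
                          (cong (λ z → #twin M lam + z) (∑⁴-+ B D))))

-- Powers and moments

^-distribʳ-* : ∀ m n k → (m * n) ^ k ≡ m ^ k * n ^ k
^-distribʳ-* m n zero    = refl
^-distribʳ-* m n (suc k) = trans (cong (m * n *_) (^-distribʳ-* m n k)) (interchange m n (m ^ k) (n ^ k))
  where
  interchange : ∀ a b c d → a * b * (c * d) ≡ a * c * (b * d)
  interchange = solve-∀

^-distribʳ-*₃ : ∀ a b c k → (a * b * c) ^ k ≡ a ^ k * b ^ k * c ^ k
^-distribʳ-*₃ a b c k = trans (^-distribʳ-* (a * b) c k) (cong (_* c ^ k) (^-distribʳ-* a b k))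

^-comm : ∀ m a b → (m ^ a) ^ b ≡ (m ^ b) ^ a
^-comm m a b = trans (ℕ.^-*-assoc m a b) (trans (cong (m ^_) (ℕ.*-comm a b)) (sym (ℕ.^-*-assoc m b a)))

^-cancelˡ-≤ : ∀ k .{{_ : NonZero k}} {m n} → m ^ k ≤ n ^ k → m ≤ n
^-cancelˡ-≤ k m^k≤n^k = ℕ.≮⇒≥ λ n<m → ℕ.<⇒≱ (ℕ.^-monoˡ-< k n<m) m^k≤n^k

2xy≤y²+x² : ∀ x y → 2 * (x * y) ≤ y * y + x * x
2xy≤y²+x² x y with ℕ.≤-total x y
... | inj₁ x≤y with k , refl ← ℕ.m≤n⇒∃[o]m+o≡n x≤y = subst (2 * (x * y) ≤_) (eq x k) (ℕ.m≤m+n _ _)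
  where
  eq : ∀ a b → 2 * (a * (a + b)) + b * b ≡ (a + b) * (a + b) + a * a
  eq = solve-∀
... | inj₂ y≤x with k , refl ← ℕ.m≤n⇒∃[o]m+o≡n y≤x = subst (2 * (x * y) ≤_) (eq y k) (ℕ.m≤m+n _ _)
  where
  eq : ∀ a b → 2 * ((a + b) * a) + b * b ≡ a * a + (a + b) * (a + b)
  eq = solve-∀

μ : ∀ {m} → (Fin m → ℕ) → ℕ → ℕ
μ {m} x j = ∑[ l < m ] (x l ^ j)

-- Termwise 2zx ≤ x² + z², weighted by x^j. With `z` the newly added entry it bounds the cross term
-- in the induction for `μ-logConvex`.
amgm-μ : ∀ {m} (x : Fin m → ℕ) z j → 2 * (z * μ x (1 + j)) ≤ μ x (2 + j) + z * z * μ x j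
amgm-μ {zero}  x z j = ℕ.≤-trans (ℕ.≤-reflexive (cong (2 *_) (ℕ.*-zeroʳ z))) z≤n
amgm-μ {suc m} x z j = begin
  2 * (z * (y * Y + s₁))               ≡⟨ eq₁ z y Y s₁ ⟩
  2 * (z * y) * Y + 2 * (z * s₁)       ≤⟨ ℕ.+-mono-≤ (ℕ.*-monoˡ-≤ Y (2xy≤y²+x² z y)) (amgm-μ (x ∘ suc) z j) ⟩
  (y * y + z * z) * Y + (s₂ + z * z * s₀) ≡⟨ eq₂ z y Y s₀ s₂ ⟩
  y * (y * Y) + s₂ + z * z * (Y + s₀)  ∎
  where
  open ℕ.≤-Reasoning
  y = x zero
  Y = y ^ j
  s₀ = μ (x ∘ suc) j
  s₁ = μ (x ∘ suc) (1 + j)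
  s₂ = μ (x ∘ suc) (2 + j)
  eq₁ : ∀ z y Y s → 2 * (z * (y * Y + s)) ≡ 2 * (z * y) * Y + 2 * (z * s)
  eq₁ = solve-∀
  eq₂ : ∀ z y Y s₀ s₂ → (y * y + z * z) * Y + (s₂ + z * z * s₀) ≡ y * (y * Y) + s₂ + z * z * (Y + s₀)
  eq₂ = solve-∀

-- Cauchy-Schwarz for the sequences x^(j/2) and x^(j/2 + 1); induction on the number of entries
-- avoids half-integral powers.
μ-logConvex : ∀ {m} (x : Fin m → ℕ) j → μ x (1 + j) * μ x (1 + j) ≤ μ x j * μ x (2 + j)
μ-logConvex {zero}  x j = z≤n
μ-logConvex {suc m} x j = begin
  (y * Y + s₁) * (y * Y + s₁)
    ≡⟨ eq₁ y Y s₁ ⟩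
  y * Y * (y * Y) + Y * (2 * (y * s₁)) + s₁ * s₁
    ≤⟨ ℕ.+-mono-≤ (ℕ.+-monoʳ-≤ (y * Y * (y * Y)) (ℕ.*-monoʳ-≤ Y (amgm-μ (x ∘ suc) y j))) (μ-logConvex (x ∘ suc) j) ⟩
  y * Y * (y * Y) + Y * (s₂ + y * y * s₀) + s₀ * s₂
    ≡⟨ eq₂ y Y s₀ s₂ ⟩
  (Y + s₀) * (y * (y * Y) + s₂) ∎
  where
  open ℕ.≤-Reasoning
  y = x zero
  Y = y ^ j
  s₀ = μ (x ∘ suc) j
  s₁ = μ (x ∘ suc) (1 + j)
  s₂ = μ (x ∘ suc) (2 + j)
  eq₁ : ∀ y Y s → (y * Y + s) * (y * Y + s) ≡ y * Y * (y * Y) + Y * (2 * (y * s)) + s * s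
  eq₁ = solve-∀
  eq₂ : ∀ y Y s₀ s₂ → y * Y * (y * Y) + Y * (s₂ + y * y * s₀) + s₀ * s₂ ≡ (Y + s₀) * (y * (y * Y) + s₂)
  eq₂ = solve-∀

-- The power mean inequality for neighbouring exponents. Raise log-convexity to the power `suc j`,
-- insert the previous case for `μ x j`, and cancel a power of the middle moment.
μ-consecutive : ∀ {m} (x : Fin m → ℕ) j → μ x j ^ suc j ≤ μ x 0 * μ x (suc j) ^ j
μ-consecutive x zero    = ℕ.≤-refl
μ-consecutive x (suc j) = cancel (μ x (suc j)) refl
  where
  open ℕ.≤-Reasoning
  s₀ = μ x j
  s₂ = μ x (2 + j)
  -- The middle moment becomes a variable so that matching can separate the case 0, where
  -- cancellation is impossible but the claim is trivial.
  cancel : ∀ s → s ≡ μ x (suc j) → s ^ (2 + j) ≤ μ x 0 * s₂ ^ suc j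
  cancel zero    _  = z≤n
  cancel s@(suc _) eq = ℕ.*-cancelˡ-≤ (s ^ j) {{ℕ.m^n≢0 s j}} (begin
    s ^ j * s ^ (2 + j)                 ≡⟨ eq₁ s (s ^ j) ⟩
    s * s ^ j * (s * s ^ j)             ≡⟨ ^-distribʳ-* s s (suc j) ⟨
    (s * s) ^ suc j                     ≤⟨ ℕ.^-monoˡ-≤ (suc j) (subst (λ s → s * s ≤ s₀ * s₂) (sym eq) (μ-logConvex x j)) ⟩
    (s₀ * s₂) ^ suc j                   ≡⟨ ^-distribʳ-* s₀ s₂ (suc j) ⟩
    s₀ ^ suc j * s₂ ^ suc j             ≤⟨ ℕ.*-monoˡ-≤ (s₂ ^ suc j) (subst (λ s → s₀ ^ suc j ≤ μ x 0 * s ^ j) (sym eq) (μ-consecutive x j)) ⟩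
    μ x 0 * s ^ j * s₂ ^ suc j          ≡⟨ eq₂ (μ x 0) (s ^ j) (s₂ ^ suc j) ⟩
    s ^ j * (μ x 0 * s₂ ^ suc j)        ∎)
    where
    eq₁ : ∀ s S → S * (s * (s * S)) ≡ s * S * (s * S)
    eq₁ = solve-∀
    eq₂ : ∀ a b c → a * b * c ≡ b * (a * c)
    eq₂ = solve-∀

-- To pass from k to k + 1, raise to the power k + 1, use `μ-consecutive` for the k-th moment, and
-- take the k-th root.
μ₃-powerMean : ∀ {m} (x : Fin m → ℕ) i → μ x 3 ^ (3 + i) ≤ μ x 0 ^ i * μ x (3 + i) ^ 3
μ₃-powerMean x zero    = ℕ.≤-reflexive (sym (ℕ.*-identityˡ _))
μ₃-powerMean x (suc i) = ^-cancelˡ-≤ k (begin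
  (μ x 3 ^ suc k) ^ k                   ≡⟨ ^-comm (μ x 3) (suc k) k ⟩
  (μ x 3 ^ k) ^ suc k                   ≤⟨ ℕ.^-monoˡ-≤ (suc k) (μ₃-powerMean x i) ⟩
  (N ^ i * μ x k ^ 3) ^ suc k           ≡⟨ ^-distribʳ-* (N ^ i) (μ x k ^ 3) (suc k) ⟩
  (N ^ i) ^ suc k * (μ x k ^ 3) ^ suc k ≡⟨ cong ((N ^ i) ^ suc k *_) (^-comm (μ x k) 3 (suc k)) ⟩
  (N ^ i) ^ suc k * (μ x k ^ suc k) ^ 3 ≤⟨ ℕ.*-monoʳ-≤ ((N ^ i) ^ suc k) (ℕ.^-monoˡ-≤ 3 (μ-consecutive x k)) ⟩
  (N ^ i) ^ suc k * (N * μ x (suc k) ^ k) ^ 3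
    ≡⟨ cong ((N ^ i) ^ suc k *_) (trans (^-distribʳ-* N (μ x (suc k) ^ k) 3) (cong (N ^ 3 *_) (^-comm (μ x (suc k)) k 3))) ⟩
  (N ^ i) ^ suc k * (N ^ 3 * (μ x (suc k) ^ 3) ^ k)
    ≡⟨ ℕ.*-assoc ((N ^ i) ^ suc k) (N ^ 3) _ ⟨
  (N ^ i) ^ suc k * N ^ 3 * (μ x (suc k) ^ 3) ^ k
    ≡⟨ cong (_* (μ x (suc k) ^ 3) ^ k) exponents ⟩
  (N ^ suc i) ^ k * (μ x (suc k) ^ 3) ^ k
    ≡⟨ ^-distribʳ-* (N ^ suc i) (μ x (suc k) ^ 3) k ⟨
  (N ^ suc i * μ x (suc k) ^ 3) ^ k     ∎)
  where
  open ℕ.≤-Reasoning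
  k = 3 + i
  N = μ x 0
  exponent : ∀ i → i * (4 + i) + 3 ≡ (1 + i) * (3 + i)
  exponent = solve-∀
  exponents : (N ^ i) ^ suc k * N ^ 3 ≡ (N ^ suc i) ^ k
  exponents = ≡-Reasoning.begin
    (N ^ i) ^ suc k * N ^ 3   ≡-Reasoning.≡⟨ cong (_* N ^ 3) (ℕ.^-*-assoc N i (suc k)) ⟩
    N ^ (i * suc k) * N ^ 3   ≡-Reasoning.≡⟨ ℕ.^-distribˡ-+-* N (i * suc k) 3 ⟨
    N ^ (i * suc k + 3)       ≡-Reasoning.≡⟨ cong (N ^_) (exponent i) ⟩
    N ^ (suc i * k)           ≡-Reasoning.≡⟨ ℕ.^-*-assoc N (suc i) k ⟨
    (N ^ suc i) ^ k           ≡-Reasoning.∎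

μ-mono-exponent : ∀ {m} (x : Fin m → ℕ) a b → μ x (suc a) ≤ μ x (suc (a + b))
μ-mono-exponent x a b = sum-mono-≤ λ l → pow (x l)
  where
  pow : ∀ y → y ^ suc a ≤ y ^ suc (a + b)
  pow zero      = z≤n
  pow y@(suc _) = ℕ.^-monoʳ-≤ y (s≤s (ℕ.m≤m+n a b))

-- The hypotheses are the k-th powers of the analytic ones, cleared of
-- denominators, for δ = P / Q, G = G_k and v = n ^ (k - 3).
module Numerics
  (k n v r t lam f G G₁ G₂ G₃ F P Q a : ℕ)
  .{{_ : NonZero k}} .{{_ : NonZero n}} .{{_ : NonZero v}} .{{_ : NonZero r}} .{{_ : NonZero t}}
  .{{_ : NonZero P}} .{{_ : NonZero Q}}
  (n^k≡  : n ^ k ≡ n * n * n * v)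
  (F≡rt  : F ≡ r * t)
  (F≡    : F ≡ f + G₁)
  (10f≤F : 10 * f ≤ F)
  (G₁≤G₃ : G₁ ≤ G₃)
  (G₂²≤  : G₂ * G₂ ≤ G₁ * G₃)
  (G₃^k≤ : G₃ ^ k ≤ v * (G * G * G))
  (ψ≤    : n * n * v * G * (Q ^ k * Q ^ k) ≤ F ^ k * (P ^ k * P ^ k))
  (≤4ψ   : F ^ k * (P ^ k * P ^ k) ≤ 4 ^ k * (n * n * v * G * (Q ^ k * Q ^ k)))
  (≤t    : P ^ k * F ^ k ≤ n * t ^ k * Q ^ k)
  (t-1≤  : n * (t ∸ 1) ^ k * Q ^ k ≤ P ^ k * F ^ k)
  (≤lam  : F * (P * P * P) ≤ lam * n * (Q * Q * Q))
  (lam≤  : lam * n * (Q * Q * Q) ≤ F * (P * P * P) + n * (Q * Q * Q))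
  (96≤a  : 96 ≤ a)
  (≤f    : a ^ k * G ≤ f ^ k)
  (16f≤t : 16 * f ≤ t)
  where

  open ℕ.≤-Reasoning

  private
    instance
      F≢0 : NonZero F
      F≢0 = subst NonZero (sym F≡rt) (ℕ.m*n≢0 r t)
      F^k≢0 : NonZero (F ^ k)
      F^k≢0 = ℕ.m^n≢0 F k
      P^k≢0 : NonZero (P ^ k)
      P^k≢0 = ℕ.m^n≢0 P k
      Q^k≢0 : NonZero (Q ^ k)
      Q^k≢0 = ℕ.m^n≢0 Q k
      P³≢0 : NonZero (P * P * P)
      P³≢0 = ℕ.m*n≢0 (P * P) P {{ℕ.m*n≢0 P P}}
      FP³≢0 : NonZero (F * (P * P * P))
      FP³≢0 = ℕ.m*n≢0 F (P * P * P)

  lam≢0 : NonZero lam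
  lam≢0 = ≢-nonZero λ { refl → contradiction ≤lam (ℕ.<⇒≱ (>-nonZero⁻¹ (F * (P * P * P)))) }

  -- This is where f₁ ≤ 0.1 F₁ enters: the other values carry at least half of F₁. It serves to
  -- exclude f₁ = 0 and to show that rounding `lam` up is harmless.
  F≤2G₃ : F ≤ 2 * G₃
  F≤2G₃ = ℕ.+-cancelˡ-≤ F F (2 * G₃) (begin
    F + F               ≡⟨ cong₂ _+_ F≡ F≡ ⟩
    f + G₁ + (f + G₁)   ≡⟨ eq f G₁ ⟩
    2 * f + 2 * G₁      ≤⟨ ℕ.+-mono-≤ (ℕ.≤-trans (ℕ.*-monoˡ-≤ f (ℕ.m≤m+n 2 8)) 10f≤F) (ℕ.*-monoʳ-≤ 2 G₁≤G₃) ⟩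
    F + 2 * G₃          ∎)
    where
    eq : ∀ f g → f + g + (f + g) ≡ 2 * f + 2 * g
    eq = solve-∀

  a^k≢0 : NonZero (a ^ k)
  a^k≢0 = ℕ.m^n≢0 a k {{>-nonZero (ℕ.<-≤-trans z<s 96≤a)}}

  -- If `f` vanished, so would `G`, then `G₃` by the power mean bound, then `F`. Positivity is what
  -- makes `16 * f ≤ t` force t ≥ 2.
  f≢0 : f ≢ 0
  f≢0 f≡0 = contradiction F≡0 (≢-nonZero⁻¹ F)
    where
    0^k≡0 : 0 ^ k ≡ 0
    0^k≡0 = 0^ k
      where
      0^ : ∀ k .{{_ : NonZero k}} → 0 ^ k ≡ 0
      0^ (suc _) = refl
    G≡0 : G ≡ 0
    G≡0 = ℕ.m*n≡0⇒m≡0 G (a ^ k) {{a^k≢0}}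
      (trans (ℕ.*-comm G (a ^ k)) (ℕ.n≤0⇒n≡0 (subst (a ^ k * G ≤_) (trans (cong (_^ k) f≡0) 0^k≡0) ≤f)))
    G₃≡0 : G₃ ≡ 0
    G₃≡0 = ℕ.m^n≡0⇒m≡0 G₃ k (ℕ.n≤0⇒n≡0 (subst (G₃ ^ k ≤_)
      (trans (cong (λ g → v * (g * g * g)) G≡0) (ℕ.*-zeroʳ v)) G₃^k≤))
    F≡0 : F ≡ 0
    F≡0 = ℕ.n≤0⇒n≡0 (subst (λ g → F ≤ 2 * g) G₃≡0 F≤2G₃)

  -- Since t ≥ 2, rounding up at most doubles: t ≤ 2(t - 1) ≤ 2 δ F / n^(1/k).
  t^k≤ : n * t ^ k * Q ^ k ≤ 2 ^ k * (P ^ k * F ^ k)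
  t^k≤ = begin
    n * t ^ k * Q ^ k                    ≤⟨ ℕ.*-monoˡ-≤ (Q ^ k) (ℕ.*-monoʳ-≤ n (ℕ.^-monoˡ-≤ k t≤2[t-1])) ⟩
    n * (2 * (t ∸ 1)) ^ k * Q ^ k        ≡⟨ cong (λ x → n * x * Q ^ k) (^-distribʳ-* 2 (t ∸ 1) k) ⟩
    n * (2 ^ k * (t ∸ 1) ^ k) * Q ^ k    ≡⟨ eq n (2 ^ k) ((t ∸ 1) ^ k) (Q ^ k) ⟩
    2 ^ k * (n * (t ∸ 1) ^ k * Q ^ k)    ≤⟨ ℕ.*-monoʳ-≤ (2 ^ k) t-1≤ ⟩
    2 ^ k * (P ^ k * F ^ k)              ∎
    where
    eq : ∀ n a s q → n * (a * s) * q ≡ a * (n * s * q)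
    eq = solve-∀
    2≤t : 2 ≤ t
    2≤t = ℕ.≤-trans (ℕ.*-mono-≤ {2} {16} {1} {f} (s≤s (s≤s z≤n)) (ℕ.n≢0⇒n>0 f≢0)) 16f≤t
    t≤2[t-1] : t ≤ 2 * (t ∸ 1)
    t≤2[t-1] = double t 2≤t
      where
      double : ∀ t → 2 ≤ t → t ≤ 2 * (t ∸ 1)
      double (suc (suc t)) _ = s≤s (subst (suc t ≤_) (sym (ℕ.+-suc t (t + 0))) (s≤s (ℕ.m≤m+n t (t + 0))))
      double (suc zero) (s≤s ())

  ≤lam^k : F ^ k * (P ^ k * P ^ k * P ^ k) ≤ lam ^ k * (n * n * n * v) * (Q ^ k * Q ^ k * Q ^ k)
  ≤lam^k = begin
    F ^ k * (P ^ k * P ^ k * P ^ k)           ≡⟨ cong (F ^ k *_) (^-distribʳ-*₃ P P P k) ⟨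
    F ^ k * (P * P * P) ^ k                   ≡⟨ ^-distribʳ-* F (P * P * P) k ⟨
    (F * (P * P * P)) ^ k                     ≤⟨ ℕ.^-monoˡ-≤ k ≤lam ⟩
    (lam * n * (Q * Q * Q)) ^ k               ≡⟨ ^-distribʳ-*₃ lam n (Q * Q * Q) k ⟩
    lam ^ k * n ^ k * (Q * Q * Q) ^ k         ≡⟨ cong₂ _*_ (cong (lam ^ k *_) n^k≡) (^-distribʳ-*₃ Q Q Q k) ⟩
    lam ^ k * (n * n * n * v) * (Q ^ k * Q ^ k * Q ^ k) ∎

  -- In real terms lam · t ≥ F² δ⁴ / n^(1 + 1/k) ≥ F² ψ² / n^(1 + 1/k) = n^(1 - 3/k) G^(2/k).
  -- Multiplying by f ≥ a G^(1/k) gives a n^(1 - 3/k) G^(3/k) ≥ a G₃. The factor `z` clears the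
  -- denominators.
  aG₃≤lam*t*f : a * G₃ ≤ lam * t * f
  aG₃≤lam*t*f = ^-cancelˡ-≤ k (ℕ.*-cancelʳ-≤ _ _ z {{z≢0}} (begin
    (a * G₃) ^ k * z
      ≡⟨ cong (_* z) (^-distribʳ-* a G₃ k) ⟩
    a ^ k * G₃ ^ k * z
      ≤⟨ ℕ.*-monoˡ-≤ z (ℕ.*-monoʳ-≤ (a ^ k) G₃^k≤) ⟩
    a ^ k * (v * (G * G * G)) * z
      ≡⟨ eq₁ (a ^ k) v G n (Q ^ k) ⟩
    (n * n * v * G * (Q ^ k * Q ^ k)) * (n * n * v * G * (Q ^ k * Q ^ k)) * (a ^ k * G)
      ≤⟨ ℕ.*-mono-≤ (ℕ.*-mono-≤ ψ≤ ψ≤) ≤f ⟩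
    (F ^ k * (P ^ k * P ^ k)) * (F ^ k * (P ^ k * P ^ k)) * f ^ k
      ≡⟨ eq₂ (F ^ k) (P ^ k) (f ^ k) ⟩
    F ^ k * (P ^ k * P ^ k * P ^ k) * (P ^ k * F ^ k) * f ^ k
      ≤⟨ ℕ.*-monoˡ-≤ (f ^ k) (ℕ.*-mono-≤ ≤lam^k ≤t) ⟩
    (lam ^ k * (n * n * n * v) * (Q ^ k * Q ^ k * Q ^ k)) * (n * t ^ k * Q ^ k) * f ^ k
      ≡⟨ eq₃ (lam ^ k) (t ^ k) (f ^ k) n v (Q ^ k) ⟩
    lam ^ k * t ^ k * f ^ k * z
      ≡⟨ cong (_* z) (^-distribʳ-*₃ lam t f k) ⟨
    (lam * t * f) ^ k * z ∎))
    where
    Q² = Q ^ k * Q ^ k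
    z = n * n * (n * n) * v * (Q² * Q²)
    z≢0 : NonZero z
    z≢0 = ℕ.m*n≢0 _ _ {{ℕ.m*n≢0 _ v {{ℕ.m*n≢0 _ _ {{ℕ.m*n≢0 n n}} {{ℕ.m*n≢0 n n}}}}}}
                      {{ℕ.m*n≢0 Q² Q² {{Q²≢0}} {{Q²≢0}}}}
      where Q²≢0 = ℕ.m*n≢0 (Q ^ k) (Q ^ k)
    eq₁ : ∀ a v g n q → a * (v * (g * g * g)) * (n * n * (n * n) * v * (q * q * (q * q)))
                         ≡ (n * n * v * g * (q * q)) * (n * n * v * g * (q * q)) * (a * g)
    eq₁ = solve-∀
    eq₂ : ∀ F P f → (F * (P * P)) * (F * (P * P)) * f ≡ F * (P * P * P) * (P * F) * f
    eq₂ = solve-∀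
    eq₃ : ∀ l t f n v q → (l * (n * n * n * v) * (q * q * q)) * (n * t * q) * f
                           ≡ l * t * f * (n * n * (n * n) * v * (q * q * (q * q)))
    eq₃ = solve-∀

  -- Here t² ≥ δ² F² / n^(2/k) ≥ ψ F² / n^(2/k) = F n^(1 - 3/k) G^(1/k), and f² ≥ a² G^(2/k).
  a²FG₃≤[tf]² : a * a * (F * G₃) ≤ t * f * (t * f)
  a²FG₃≤[tf]² = ^-cancelˡ-≤ k (ℕ.*-cancelʳ-≤ _ _ z {{z≢0}} (begin
    (a * a * (F * G₃)) ^ k * z
      ≡⟨ cong (_* z) (trans (^-distribʳ-*₃ a a (F * G₃) k) (cong (a ^ k * a ^ k *_) (^-distribʳ-* F G₃ k))) ⟩
    a ^ k * a ^ k * (F ^ k * G₃ ^ k) * z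
      ≤⟨ ℕ.*-monoˡ-≤ z (ℕ.*-monoʳ-≤ (a ^ k * a ^ k) (ℕ.*-monoʳ-≤ (F ^ k) G₃^k≤)) ⟩
    a ^ k * a ^ k * (F ^ k * (v * (G * G * G))) * z
      ≡⟨ eq₁ (a ^ k) (F ^ k) v G n (Q ^ k) ⟩
    (n * n * v * G * (Q ^ k * Q ^ k)) * F ^ k * (a ^ k * G * (a ^ k * G))
      ≤⟨ ℕ.*-mono-≤ (ℕ.*-monoˡ-≤ (F ^ k) ψ≤) (ℕ.*-mono-≤ ≤f ≤f) ⟩
    (F ^ k * (P ^ k * P ^ k)) * F ^ k * (f ^ k * f ^ k)
      ≡⟨ eq₂ (F ^ k) (P ^ k) (f ^ k) ⟩
    P ^ k * F ^ k * (P ^ k * F ^ k) * (f ^ k * f ^ k)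
      ≤⟨ ℕ.*-monoˡ-≤ (f ^ k * f ^ k) (ℕ.*-mono-≤ ≤t ≤t) ⟩
    n * t ^ k * Q ^ k * (n * t ^ k * Q ^ k) * (f ^ k * f ^ k)
      ≡⟨ eq₃ n (t ^ k) (Q ^ k) (f ^ k) ⟩
    t ^ k * f ^ k * (t ^ k * f ^ k) * z
      ≡⟨ cong (_* z) (trans (^-distribʳ-* (t * f) (t * f) k) (cong₂ _*_ (^-distribʳ-* t f k) (^-distribʳ-* t f k))) ⟨
    (t * f * (t * f)) ^ k * z ∎))
    where
    z = n * n * (Q ^ k * Q ^ k)
    z≢0 : NonZero z
    z≢0 = ℕ.m*n≢0 _ _ {{ℕ.m*n≢0 n n}} {{ℕ.m*n≢0 (Q ^ k) (Q ^ k)}}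
    eq₁ : ∀ a F v g n q → a * a * (F * (v * (g * g * g))) * (n * n * (q * q))
                         ≡ (n * n * v * g * (q * q)) * F * (a * g * (a * g))
    eq₁ = solve-∀
    eq₂ : ∀ F P f → (F * (P * P)) * F * (f * f) ≡ P * F * (P * F) * (f * f)
    eq₂ = solve-∀
    eq₃ : ∀ n t q f → n * t * q * (n * t * q) * (f * f) ≡ t * f * (t * f) * (n * n * (q * q))
    eq₃ = solve-∀

  aG₂≤t*f : a * G₂ ≤ t * f
  aG₂≤t*f = ^-cancelˡ-≤ 2 (begin
    (a * G₂) ^ 2                ≡⟨ eq₁ a G₂ ⟩
    a * a * (G₂ * G₂)           ≤⟨ ℕ.*-monoʳ-≤ (a * a) (ℕ.≤-trans G₂²≤ (ℕ.*-monoˡ-≤ G₃ (subst (G₁ ≤_) (sym F≡) (ℕ.m≤n+m G₁ f)))) ⟩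
    a * a * (F * G₃)            ≤⟨ a²FG₃≤[tf]² ⟩
    t * f * (t * f)             ≡⟨ cong (t * f *_) (ℕ.*-identityʳ (t * f)) ⟨
    (t * f) ^ 2                 ∎)
    where
    eq₁ : ∀ a g → a * g * (a * g * 1) ≡ a * a * (g * g)
    eq₁ = solve-∀

  -- That is, n ≤ 2 F δ³, so the ceiling that defines `lam` at most triples F δ³ / n. It follows
  -- from n² G₃ ≤ F³ δ⁶ and F ≤ 2 G₃.
  nQ³≤2FP³ : n * (Q * Q * Q) ≤ 2 * (F * (P * P * P))
  nQ³≤2FP³ = ^-cancelˡ-≤ 2 (ℕ.*-cancelʳ-≤ _ _ F (begin
    (n * (Q * Q * Q)) ^ 2 * F
      ≤⟨ ℕ.*-monoʳ-≤ ((n * (Q * Q * Q)) ^ 2) F≤2G₃ ⟩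
    (n * (Q * Q * Q)) ^ 2 * (2 * G₃)
      ≡⟨ eq₁ n Q G₃ ⟩
    2 * (n * n * (Q³ * Q³) * G₃)
      ≤⟨ ℕ.*-monoʳ-≤ 2 cubed ⟩
    2 * (F * F * F * (P³ * P³))
      ≤⟨ ℕ.*-monoˡ-≤ (F * F * F * (P³ * P³)) (ℕ.m≤m+n 2 2) ⟩
    4 * (F * F * F * (P³ * P³))
      ≡⟨ eq₂ F P ⟩
    (2 * (F * (P * P * P))) ^ 2 * F ∎))
    where
    P³ = P * P * P
    Q³ = Q * Q * Q
    eq₁ : ∀ n Q g → (n * (Q * Q * Q)) * ((n * (Q * Q * Q)) * 1) * (2 * g) ≡ 2 * (n * n * (Q * Q * Q * (Q * Q * Q)) * g)
    eq₁ = solve-∀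
    eq₂ : ∀ F P → 4 * (F * F * F * (P * P * P * (P * P * P)))
                   ≡ (2 * (F * (P * P * P))) * ((2 * (F * (P * P * P))) * 1) * F
    eq₂ = solve-∀
    -- n² G₃ ≤ n^(3 - 3/k) G^(3/k) = (F ψ)³ ≤ F³ δ⁶.
    cubed : n * n * (Q³ * Q³) * G₃ ≤ F * F * F * (P³ * P³)
    cubed = ^-cancelˡ-≤ k (begin
      (n * n * (Q³ * Q³) * G₃) ^ k
        ≡⟨ trans (^-distribʳ-*₃ (n * n) (Q³ * Q³) G₃ k) (cong (_* G₃ ^ k) (cong₂ _*_ (^-distribʳ-* n n k)
             (trans (^-distribʳ-* Q³ Q³ k) (cong₂ _*_ (^-distribʳ-*₃ Q Q Q k) (^-distribʳ-*₃ Q Q Q k))))) ⟩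
      n ^ k * n ^ k * (Q ^ k * Q ^ k * Q ^ k * (Q ^ k * Q ^ k * Q ^ k)) * G₃ ^ k
        ≡⟨ cong (λ x → x * x * (Q ^ k * Q ^ k * Q ^ k * (Q ^ k * Q ^ k * Q ^ k)) * G₃ ^ k) n^k≡ ⟩
      n * n * n * v * (n * n * n * v) * (Q ^ k * Q ^ k * Q ^ k * (Q ^ k * Q ^ k * Q ^ k)) * G₃ ^ k
        ≤⟨ ℕ.*-monoʳ-≤ (n * n * n * v * (n * n * n * v) * (Q ^ k * Q ^ k * Q ^ k * (Q ^ k * Q ^ k * Q ^ k))) G₃^k≤ ⟩
      n * n * n * v * (n * n * n * v) * (Q ^ k * Q ^ k * Q ^ k * (Q ^ k * Q ^ k * Q ^ k)) * (v * (G * G * G))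
        ≡⟨ eq₃ n v (Q ^ k) G ⟩
      n * n * v * G * (Q ^ k * Q ^ k) * (n * n * v * G * (Q ^ k * Q ^ k)) * (n * n * v * G * (Q ^ k * Q ^ k))
        ≤⟨ ℕ.*-mono-≤ (ℕ.*-mono-≤ ψ≤ ψ≤) ψ≤ ⟩
      F ^ k * (P ^ k * P ^ k) * (F ^ k * (P ^ k * P ^ k)) * (F ^ k * (P ^ k * P ^ k))
        ≡⟨ eq₄ (F ^ k) (P ^ k) ⟩
      F ^ k * F ^ k * F ^ k * (P ^ k * P ^ k * P ^ k * (P ^ k * P ^ k * P ^ k))
        ≡⟨ trans (^-distribʳ-* (F * F * F) (P³ * P³) k) (cong₂ _*_ (^-distribʳ-*₃ F F F k)
             (trans (^-distribʳ-* P³ P³ k) (cong₂ _*_ (^-distribʳ-*₃ P P P k) (^-distribʳ-*₃ P P P k)))) ⟨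
      (F * F * F * (P³ * P³)) ^ k ∎)
      where
      eq₃ : ∀ n v q g → n * n * n * v * (n * n * n * v) * (q * q * q * (q * q * q)) * (v * (g * g * g))
                         ≡ n * n * v * g * (q * q) * (n * n * v * g * (q * q)) * (n * n * v * g * (q * q))
      eq₃ = solve-∀
      eq₄ : ∀ F P → F * (P * P) * (F * (P * P)) * (F * (P * P)) ≡ F * F * F * (P * P * P * (P * P * P))
      eq₄ = solve-∀

  lam^k≤ : lam ^ k * (n * n * n * v) * (Q ^ k * Q ^ k * Q ^ k) ≤ 3 ^ k * (F ^ k * (P ^ k * P ^ k * P ^ k))
  lam^k≤ = begin
    lam ^ k * (n * n * n * v) * (Q ^ k * Q ^ k * Q ^ k)
      ≡⟨ cong₂ _*_ (cong (lam ^ k *_) n^k≡) (^-distribʳ-*₃ Q Q Q k) ⟨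
    lam ^ k * n ^ k * (Q * Q * Q) ^ k
      ≡⟨ ^-distribʳ-*₃ lam n (Q * Q * Q) k ⟨
    (lam * n * (Q * Q * Q)) ^ k
      ≤⟨ ℕ.^-monoˡ-≤ k (ℕ.≤-trans lam≤ (ℕ.+-monoʳ-≤ _ nQ³≤2FP³)) ⟩
    (3 * (F * (P * P * P))) ^ k
      ≡⟨ trans (^-distribʳ-* 3 (F * (P * P * P)) k) (cong (3 ^ k *_) (trans (^-distribʳ-* F (P * P * P) k)
           (cong (F ^ k *_) (^-distribʳ-*₃ P P P k)))) ⟩
    3 ^ k * (F ^ k * (P ^ k * P ^ k * P ^ k)) ∎

  -- With r = F / t ≤ n^(1/k) / δ and lam ≤ 3 F δ³ / n, the product is at most 3 F δ² / n^(1 - 1/k)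
  -- ≤ 12 F ψ / n^(1 - 1/k) = 12 G^(1/k). The 3 comes from rounding `lam`, the 4 from rounding δ.
  a*r*lam≤12f : a * (r * lam) ≤ 3 * 4 * f
  a*r*lam≤12f = ^-cancelˡ-≤ k (ℕ.*-cancelʳ-≤ _ _ z {{z≢0}} (begin
    (a * (r * lam)) ^ k * z
      ≡⟨ cong (_* z) (trans (^-distribʳ-* a (r * lam) k) (cong (a ^ k *_) (^-distribʳ-* r lam k))) ⟩
    a ^ k * (r ^ k * lam ^ k) * z
      ≡⟨ eq₁ (a ^ k) (r ^ k) (lam ^ k) n v (Q ^ k) (P ^ k) (F ^ k) ⟩
    a ^ k * r ^ k * (lam ^ k * (n * n * v) * (Q ^ k * Q ^ k)) * (P ^ k * F ^ k)
      ≤⟨ ℕ.*-monoʳ-≤ (a ^ k * r ^ k * (lam ^ k * (n * n * v) * (Q ^ k * Q ^ k))) ≤t ⟩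
    a ^ k * r ^ k * (lam ^ k * (n * n * v) * (Q ^ k * Q ^ k)) * (n * t ^ k * Q ^ k)
      ≡⟨ eq₂ (a ^ k) (r ^ k) (lam ^ k) n v (Q ^ k) (t ^ k) ⟩
    a ^ k * (r ^ k * t ^ k) * (lam ^ k * (n * n * n * v) * (Q ^ k * Q ^ k * Q ^ k))
      ≡⟨ cong (λ x → a ^ k * x * (lam ^ k * (n * n * n * v) * (Q ^ k * Q ^ k * Q ^ k)))
              (trans (sym (^-distribʳ-* r t k)) (cong (_^ k) (sym F≡rt))) ⟩
    a ^ k * F ^ k * (lam ^ k * (n * n * n * v) * (Q ^ k * Q ^ k * Q ^ k))
      ≤⟨ ℕ.*-monoʳ-≤ (a ^ k * F ^ k) lam^k≤ ⟩
    a ^ k * F ^ k * (3 ^ k * (F ^ k * (P ^ k * P ^ k * P ^ k)))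
      ≡⟨ eq₃ (a ^ k) (F ^ k) (3 ^ k) (P ^ k) ⟩
    3 ^ k * a ^ k * (P ^ k * F ^ k) * (F ^ k * (P ^ k * P ^ k))
      ≤⟨ ℕ.*-monoʳ-≤ (3 ^ k * a ^ k * (P ^ k * F ^ k)) ≤4ψ ⟩
    3 ^ k * a ^ k * (P ^ k * F ^ k) * (4 ^ k * (n * n * v * G * (Q ^ k * Q ^ k)))
      ≡⟨ eq₄ (a ^ k) (F ^ k) (3 ^ k) (P ^ k) (4 ^ k) n v G (Q ^ k) ⟩
    3 ^ k * 4 ^ k * (a ^ k * G) * z
      ≤⟨ ℕ.*-monoˡ-≤ z (ℕ.*-monoʳ-≤ (3 ^ k * 4 ^ k) ≤f) ⟩
    3 ^ k * 4 ^ k * f ^ k * z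
      ≡⟨ cong (_* z) (^-distribʳ-*₃ 3 4 f k) ⟨
    (3 * 4 * f) ^ k * z ∎))
    where
    z = n * n * v * (Q ^ k * Q ^ k) * (P ^ k * F ^ k)
    z≢0 : NonZero z
    z≢0 = ℕ.m*n≢0 _ _ {{ℕ.m*n≢0 _ _ {{ℕ.m*n≢0 (n * n) v {{ℕ.m*n≢0 n n}}}} {{ℕ.m*n≢0 (Q ^ k) (Q ^ k)}}}}
                      {{ℕ.m*n≢0 (P ^ k) (F ^ k)}}
    eq₁ : ∀ a r l n v q p F → a * (r * l) * (n * n * v * (q * q) * (p * F)) ≡ a * r * (l * (n * n * v) * (q * q)) * (p * F)
    eq₁ = solve-∀
    eq₂ : ∀ a r l n v q t → a * r * (l * (n * n * v) * (q * q)) * (n * t * q) ≡ a * (r * t) * (l * (n * n * n * v) * (q * q * q))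
    eq₂ = solve-∀
    eq₃ : ∀ a F c p → a * F * (c * (F * (p * p * p))) ≡ c * a * (p * F) * (F * (p * p))
    eq₃ = solve-∀
    eq₄ : ∀ a F c p e n v g q → c * a * (p * F) * (e * (n * n * v * g * (q * q))) ≡ c * e * (a * g) * (n * n * v * (q * q) * (p * F))
    eq₄ = solve-∀

  -- R = t ^ r counts the outcomes and c those with S = 1.
  module _ (R c good twin block drop : ℕ)
    (count  : R * (t * good) ≤ t * t * c + R * (twin + (block + drop)))
    (good≥  : f ≤ good + r * lam)
    (twin≤  : twin ≤ f * f)
    (block≤ : lam * block ≤ G₃)
    (drop≤  : drop ≤ f * f + G₂)
    where

    private
      8r*lam≤f : 8 * (r * lam) ≤ f
      8r*lam≤f = ℕ.*-cancelˡ-≤ 12 (begin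
        12 * (8 * (r * lam)) ≡⟨ eq (r * lam) ⟩
        96 * (r * lam)       ≤⟨ ℕ.*-monoˡ-≤ (r * lam) 96≤a ⟩
        a * (r * lam)        ≤⟨ a*r*lam≤12f ⟩
        12 * f               ∎)
        where
        eq : ∀ x → 12 * (8 * x) ≡ 96 * x
        eq = solve-∀

      8≤a : 8 ≤ a
      8≤a = ℕ.≤-trans (ℕ.m≤m+n 8 88) 96≤a

      8block≤t*f : 8 * block ≤ t * f
      8block≤t*f = ℕ.*-cancelˡ-≤ lam {{lam≢0}} (begin
        lam * (8 * block)  ≡⟨ eq lam block ⟩
        8 * (lam * block)  ≤⟨ ℕ.*-mono-≤ 8≤a block≤ ⟩
        a * G₃             ≤⟨ aG₃≤lam*t*f ⟩
        lam * t * f        ≡⟨ ℕ.*-assoc lam t f ⟩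
        lam * (t * f)      ∎)
        where
        eq : ∀ l b → l * (8 * b) ≡ 8 * (l * b)
        eq = solve-∀

      8G₂≤t*f : 8 * G₂ ≤ t * f
      8G₂≤t*f = ℕ.≤-trans (ℕ.*-monoˡ-≤ G₂ 8≤a) aG₂≤t*f

      -- Four losses of at most tf / 8 each: the two f² together, the blocks, `G₂`, and
      -- `t * (r * lam)` for the occurrences that are not good.
      losses : 8 * (twin + (block + drop) + t * (r * lam)) ≤ 4 * (t * f)
      losses = begin
        8 * (twin + (block + drop) + t * (r * lam))
          ≤⟨ ℕ.*-monoʳ-≤ 8 (ℕ.+-monoˡ-≤ (t * (r * lam)) (ℕ.+-mono-≤ twin≤ (ℕ.+-monoʳ-≤ block drop≤))) ⟩
        8 * (f * f + (block + (f * f + G₂)) + t * (r * lam))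
          ≡⟨ eq₁ f block G₂ t (r * lam) ⟩
        16 * f * f + 8 * block + 8 * G₂ + t * (8 * (r * lam))
          ≤⟨ ℕ.+-mono-≤ (ℕ.+-mono-≤ (ℕ.+-mono-≤ (ℕ.*-monoˡ-≤ f 16f≤t) 8block≤t*f) 8G₂≤t*f) (ℕ.*-monoʳ-≤ t 8r*lam≤f) ⟩
        t * f + t * f + t * f + t * f
          ≡⟨ eq₂ (t * f) ⟩
        4 * (t * f) ∎
        where
        eq₁ : ∀ f b g t x → 8 * (f * f + (b + (f * f + g)) + t * x) ≡ 16 * f * f + 8 * b + 8 * g + t * (8 * x)
        eq₁ = solve-∀
        eq₂ : ∀ x → x + x + x + x ≡ 4 * x
        eq₂ = solve-∀

    R*f≤2tc : R * f ≤ 2 * (t * c)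
    R*f≤2tc = ℕ.*-cancelˡ-≤ (4 * t) {{ℕ.m*n≢0 4 t}} (ℕ.+-cancelʳ-≤ (R * (4 * (t * f))) _ _ (begin
      4 * t * (R * f) + R * (4 * (t * f))
        ≡⟨ eq₁ t R f ⟩
      8 * (R * (t * f))
        ≤⟨ ℕ.*-monoʳ-≤ 8 (ℕ.*-monoʳ-≤ R (ℕ.*-monoʳ-≤ t good≥)) ⟩
      8 * (R * (t * (good + r * lam)))
        ≡⟨ eq₂ R t good (r * lam) ⟩
      8 * (R * (t * good)) + 8 * (R * (t * (r * lam)))
        ≤⟨ ℕ.+-monoˡ-≤ (8 * (R * (t * (r * lam)))) (ℕ.*-monoʳ-≤ 8 count) ⟩
      8 * (t * t * c + R * (twin + (block + drop))) + 8 * (R * (t * (r * lam)))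
        ≡⟨ eq₃ (t * t * c) R (twin + (block + drop)) (t * (r * lam)) ⟩
      8 * (t * t * c) + R * (8 * (twin + (block + drop) + t * (r * lam)))
        ≤⟨ ℕ.+-monoʳ-≤ (8 * (t * t * c)) (ℕ.*-monoʳ-≤ R losses) ⟩
      8 * (t * t * c) + R * (4 * (t * f))
        ≡⟨ cong (_+ R * (4 * (t * f))) (eq₄ t c) ⟩
      4 * t * (2 * (t * c)) + R * (4 * (t * f)) ∎))
      where
      eq₁ : ∀ t R f → 4 * t * (R * f) + R * (4 * (t * f)) ≡ 8 * (R * (t * f))
      eq₁ = solve-∀
      eq₂ : ∀ R t g x → 8 * (R * (t * (g + x))) ≡ 8 * (R * (t * g)) + 8 * (R * (t * x))
      eq₂ = solve-∀
      eq₃ : ∀ x R y z → 8 * (x + R * y) + 8 * (R * z) ≡ 8 * x + R * (8 * (y + z))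
      eq₃ = solve-∀
      eq₄ : ∀ t c → 8 * (t * t * c) ≡ 4 * t * (2 * (t * c))
      eq₄ = solve-∀

    -- Cancelling 8^k costs `8 ≤ a`: a factor 4 for δ² ≤ 4ψ and a factor 2 for the rounding of t.
    conclusion : P ^ k * R ^ k ≤ c ^ k * (2 ^ k * (n * v) * Q ^ k)
    conclusion = ℕ.*-cancelʳ-≤ _ _ (8 ^ k) {{ℕ.m^n≢0 8 k}} (ℕ.*-cancelʳ-≤ _ _ (P ^ k * F ^ k) {{ℕ.m*n≢0 (P ^ k) (F ^ k)}} (begin
      P ^ k * R ^ k * 8 ^ k * (P ^ k * F ^ k)
        ≤⟨ ℕ.*-monoˡ-≤ (P ^ k * F ^ k) (ℕ.*-monoʳ-≤ (P ^ k * R ^ k) (ℕ.^-monoˡ-≤ k 8≤a)) ⟩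
      P ^ k * R ^ k * a ^ k * (P ^ k * F ^ k)
        ≡⟨ eq₁ (P ^ k) (R ^ k) (a ^ k) (F ^ k) ⟩
      R ^ k * a ^ k * (F ^ k * (P ^ k * P ^ k))
        ≤⟨ ℕ.*-monoʳ-≤ (R ^ k * a ^ k) ≤4ψ ⟩
      R ^ k * a ^ k * (4 ^ k * (n * n * v * G * (Q ^ k * Q ^ k)))
        ≡⟨ eq₂ (R ^ k) (a ^ k) (4 ^ k) n v G (Q ^ k) ⟩
      R ^ k * (a ^ k * G) * (4 ^ k * (n * v * Q ^ k) * (n * Q ^ k))
        ≤⟨ ℕ.*-monoˡ-≤ _ (ℕ.*-monoʳ-≤ (R ^ k) ≤f) ⟩
      R ^ k * f ^ k * (4 ^ k * (n * v * Q ^ k) * (n * Q ^ k))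
        ≤⟨ ℕ.*-monoˡ-≤ _ [Rf]^k≤ ⟩
      2 ^ k * (t ^ k * c ^ k) * (4 ^ k * (n * v * Q ^ k) * (n * Q ^ k))
        ≡⟨ eq₃ (2 ^ k) (t ^ k) (c ^ k) (4 ^ k) n v (Q ^ k) ⟩
      2 ^ k * c ^ k * (4 ^ k * (n * v * Q ^ k)) * (n * t ^ k * Q ^ k)
        ≤⟨ ℕ.*-monoʳ-≤ (2 ^ k * c ^ k * (4 ^ k * (n * v * Q ^ k))) t^k≤ ⟩
      2 ^ k * c ^ k * (4 ^ k * (n * v * Q ^ k)) * (2 ^ k * (P ^ k * F ^ k))
        ≡⟨ eq₄ (2 ^ k) (c ^ k) (4 ^ k) n v (Q ^ k) (P ^ k * F ^ k) ⟩
      c ^ k * (2 ^ k * (n * v) * Q ^ k) * (2 ^ k * 4 ^ k) * (P ^ k * F ^ k)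
        ≡⟨ cong (λ x → c ^ k * (2 ^ k * (n * v) * Q ^ k) * x * (P ^ k * F ^ k)) (^-distribʳ-* 2 4 k) ⟨
      c ^ k * (2 ^ k * (n * v) * Q ^ k) * 8 ^ k * (P ^ k * F ^ k) ∎))
      where
      [Rf]^k≤ : R ^ k * f ^ k ≤ 2 ^ k * (t ^ k * c ^ k)
      [Rf]^k≤ = begin
        R ^ k * f ^ k            ≡⟨ ^-distribʳ-* R f k ⟨
        (R * f) ^ k              ≤⟨ ℕ.^-monoˡ-≤ k R*f≤2tc ⟩
        (2 * (t * c)) ^ k        ≡⟨ trans (^-distribʳ-* 2 (t * c) k) (cong (2 ^ k *_) (^-distribʳ-* t c k)) ⟩
        2 ^ k * (t ^ k * c ^ k)  ∎
      eq₁ : ∀ p R a F → p * R * a * (p * F) ≡ R * a * (F * (p * p))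
      eq₁ = solve-∀
      eq₂ : ∀ R a e n v g q → R * a * (e * (n * n * v * g * (q * q))) ≡ R * (a * g) * (e * (n * v * q) * (n * q))
      eq₂ = solve-∀
      eq₃ : ∀ d t c e n v q → d * (t * c) * (e * (n * v * q) * (n * q)) ≡ d * c * (e * (n * v * q)) * (n * t * q)
      eq₃ = solve-∀
      eq₄ : ∀ d c e n v q x → d * c * (e * (n * v * q)) * (d * x) ≡ c * (d * (n * v) * q) * (d * e) * x
      eq₄ = solve-∀

-- Nonnegative rationals as quotients of natural numbers

infix 4 _≃_∕_

-- The fraction need not be reduced, so numerator and denominator can be kept in the form the
-- estimates want, and the order on rationals turns into inequalities in ℕ by cross-multiplication.
record _≃_∕_ (x : ℚᵘ) (a b : ℕ) : Set where
  constructor ratio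
  field
    {{b≢0}} : NonZero b
    x≃a/b   : x ≃ + a / b

ratio-/ : ∀ a b .{{_ : NonZero b}} → + a / b ≃ a ∕ b
ratio-/ a b@(suc _) = ratio ℚ.≃-refl

ratio-resp : ∀ {x a b c} d .{{_ : NonZero d}} → x ≃ a ∕ b → a * d ≡ c * b → x ≃ c ∕ d
ratio-resp {a = a} {suc b} {c} d@(suc _) (ratio x≃) ad≡cb = ratio (ℚ.≃-trans x≃
  (*≡* (trans (sym (ℤ.pos-* a d)) (trans (cong +_ ad≡cb) (ℤ.pos-* c (suc b))))))

ratio-cong : ∀ {x a b a′ b′} → a ≡ a′ → b ≡ b′ → x ≃ a ∕ b → x ≃ a′ ∕ b′
ratio-cong refl refl x≃ = x≃

ratio-* : ∀ {x y a b c d} → x ≃ a ∕ b → y ≃ c ∕ d → x ℚ.* y ≃ a * c ∕ b * d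
ratio-* {a = a} {b = suc _} {c} {suc _} (ratio x≃) (ratio y≃) =
  ratio (ℚ.≃-trans (ℚ.*-cong x≃ y≃) (ℚ.≃-reflexive (cong (λ z → mkℚᵘ z _) (sym (ℤ.pos-* a c)))))

ratio-÷ : ∀ {x y a b c d} .{{_ : ℚ.NonZero y}} → x ≃ a ∕ b → y ≃ c ∕ d → x ℚ.÷ y ≃ a * d ∕ b * c
ratio-÷ {x@record{}} {y@record{}} x≃ y≃ = ratio-* x≃ (inverse y≃)
  where
  inverse : ∀ {y c d} .{{_ : ℚ.NonZero y}} → y ≃ c ∕ d → ℚ.1/ y ≃ d ∕ c
  inverse {mkℚᵘ +[1+ n ] e} {suc c} {suc d} (ratio (*≡* eq)) =
    ratio (*≡* (trans (ℤ.*-comm +[1+ e ] +[1+ c ]) (trans (sym eq) (ℤ.*-comm +[1+ n ] +[1+ d ]))))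
  inverse {mkℚᵘ +[1+ n ] e} {zero}  {suc d} (ratio (*≡* ()))
  inverse {mkℚᵘ -[1+ n ] e} {zero}  {suc d} (ratio (*≡* ()))
  inverse {mkℚᵘ -[1+ n ] e} {suc c} {suc d} (ratio (*≡* ()))

ratio-^ : ∀ {x a b} → x ≃ a ∕ b → ∀ k → x ^ℚ k ≃ a ^ k ∕ b ^ k
ratio-^ x≃ zero    = ratio ℚ.≃-refl
ratio-^ x≃ (suc k) = ratio-* x≃ (ratio-^ x≃ k)

ratio-ℕ^ : ∀ m k → (+ m / 1) ^ℚ k ≃ m ^ k ∕ 1
ratio-ℕ^ m k = subst ((+ m / 1) ^ℚ k ≃ m ^ k ∕_) (ℕ.^-zeroˡ k) (ratio-^ (ratio-/ m 1) k)

ratio-≤⁻ : ∀ {x y a b c d} → x ≃ a ∕ b → y ≃ c ∕ d → x ℚ.≤ y → a * d ≤ c * b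
ratio-≤⁻ {a = a} {suc b} {c} {suc d} (ratio x≃) (ratio y≃) x≤y =
  ℤ.drop‿+≤+ (subst₂ ℤ._≤_ (sym (ℤ.pos-* a (suc d))) (sym (ℤ.pos-* c (suc b)))
    (ℚ.drop-*≤* (ℚ.≤-respˡ-≃ x≃ (ℚ.≤-respʳ-≃ y≃ x≤y))))

ratio-≤⁺ : ∀ {x y a b c d} → x ≃ a ∕ b → y ≃ c ∕ d → a * d ≤ c * b → x ℚ.≤ y
ratio-≤⁺ {a = a} {suc b} {c} {suc d} (ratio x≃) (ratio y≃) ad≤cb =
  ℚ.≤-respˡ-≃ (ℚ.≃-sym x≃) (ℚ.≤-respʳ-≃ (ℚ.≃-sym y≃)
    (*≤* (subst₂ ℤ._≤_ (ℤ.pos-* a (suc d)) (ℤ.pos-* c (suc b)) (ℤ.+≤+ ad≤cb))))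

-- Extracts what minimality of a ceiling says: the next smaller candidate fails to be an upper
-- bound.
ratio-≰⁻ : ∀ {x y a b c d} → x ≃ a ∕ b → y ≃ c ∕ d → ¬ (x ℚ.≤ y) → c * b ≤ a * d
ratio-≰⁻ x≃ y≃ x≰y = ratio-≤⁻ y≃ x≃ (ℚ.≰⇒≥ x≰y)

-- The ceiling is the negated floor of -x. Dividing -N by D leaves a remainder ρ < D with m D = N +
-- ρ, which yields x ≤ m ≤ x + 1.
ratio-ceiling : ∀ {x a b m} → x ≃ a ∕ b → + m ≡ ceiling x → a ≤ m * b × m * b ≤ a + b
ratio-ceiling {mkℚᵘ N e} {a} {b@(suc _)} {m} (ratio (*≡* N*b≡a*D)) m≡ =
  ℕ.*-cancelʳ-≤ a (m * b) D (subst (a * D ≤_) divided (ℕ.m≤m+n (a * D) (ρ * b))) ,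
  ℕ.*-cancelʳ-≤ (m * b) (a + b) D (begin
    m * b * D        ≡⟨ divided ⟨
    a * D + ρ * b    ≤⟨ ℕ.+-monoʳ-≤ (a * D) (ℕ.*-monoˡ-≤ b (ℕ.<⇒≤ (ℤ.n%d<d (ℤ.- N) (+ D)))) ⟩
    a * D + D * b    ≡⟨ cong (λ z → a * D + z) (ℕ.*-comm D b) ⟩
    a * D + b * D    ≡⟨ ℕ.*-distribʳ-+ D a b ⟨
    (a + b) * D      ∎)
  where
  D = suc e
  ρ = (ℤ.- N) ℤ.% (+ D)
  quotient : (ℤ.- N) ℤ./ (+ D) ≡ ℤ.- (+ m)
  quotient = trans (sym (ℤ.neg-involutive _)) (cong ℤ.-_ (sym m≡))
  -N≡ : ℤ.- N ≡ + ρ ℤ.+ ℤ.- (+ m) ℤ.* + D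
  -N≡ = trans (ℤ.a≡a%n+[a/n]*n (ℤ.- N) (+ D)) (cong (λ z → + ρ ℤ.+ z ℤ.* + D) quotient)
  scaled : + a ℤ.* + D ℤ.+ + ρ ℤ.* + b ≡ + m ℤ.* + b ℤ.* + D
  scaled = ≡-Reasoning.begin
    + a ℤ.* + D ℤ.+ + ρ ℤ.* + b
      ≡-Reasoning.≡⟨ cong (ℤ._+ + ρ ℤ.* + b) N*b≡a*D ⟨
    N ℤ.* + b ℤ.+ + ρ ℤ.* + b
      ≡-Reasoning.≡⟨ cong (λ z → z ℤ.* + b ℤ.+ + ρ ℤ.* + b) (ℤ.neg-involutive N) ⟨
    ℤ.- (ℤ.- N) ℤ.* + b ℤ.+ + ρ ℤ.* + b
      ≡-Reasoning.≡⟨ cong (λ z → ℤ.- z ℤ.* + b ℤ.+ + ρ ℤ.* + b) -N≡ ⟩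
    ℤ.- (+ ρ ℤ.+ ℤ.- (+ m) ℤ.* + D) ℤ.* + b ℤ.+ + ρ ℤ.* + b
      ≡-Reasoning.≡⟨ eq (+ ρ) (+ m) (+ D) (+ b) ⟩
    + m ℤ.* + b ℤ.* + D ≡-Reasoning.∎
    where
    eq : ∀ r m D b → ℤ.- (r ℤ.+ ℤ.- m ℤ.* D) ℤ.* b ℤ.+ r ℤ.* b ≡ m ℤ.* b ℤ.* D
    eq = ℤ-solve-∀
  divided : a * D + ρ * b ≡ m * b * D
  divided = ℤ.+-injective (≡-Reasoning.begin
    + (a * D + ρ * b)               ≡-Reasoning.≡⟨ ℤ.pos-+ (a * D) (ρ * b) ⟩
    + (a * D) ℤ.+ + (ρ * b)         ≡-Reasoning.≡⟨ cong₂ ℤ._+_ (ℤ.pos-* a D) (ℤ.pos-* ρ b) ⟩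
    + a ℤ.* + D ℤ.+ + ρ ℤ.* + b     ≡-Reasoning.≡⟨ scaled ⟩
    + m ℤ.* + b ℤ.* + D             ≡-Reasoning.≡⟨ cong (ℤ._* + D) (ℤ.pos-* m b) ⟨
    + (m * b) ℤ.* + D               ≡-Reasoning.≡⟨ ℤ.pos-* (m * b) D ⟨
    + (m * b * D)                   ≡-Reasoning.∎)
  open ℕ.≤-Reasoning

2^⁺ 2^⁻ : ℤ → ℕ
2^⁺ (+ a)    = 2 ^ a
2^⁺ -[1+ a ] = 1
2^⁻ (+ a)    = 1
2^⁻ -[1+ a ] = 2 ^ suc a

2^⁺≢0 : ∀ e → NonZero (2^⁺ e)
2^⁺≢0 (+ a)    = ℕ.m^n≢0 2 a
2^⁺≢0 -[1+ a ] = _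

2^⁻≢0 : ∀ e → NonZero (2^⁻ e)
2^⁻≢0 (+ a)    = _
2^⁻≢0 -[1+ a ] = ℕ.m^n≢0 2 (suc a)

ratio-2^ : ∀ e → 2^ e ≃ 2^⁺ e ∕ 2^⁻ e
ratio-2^ (+ a)    = ratio-/ (2 ^ a) 1
ratio-2^ -[1+ a ] = ratio-/ 1 (2 ^ suc a) {{ℕ.m^n≢0 2 (suc a)}}

ratio-2^[e+e] : ∀ e → 2^ (e ℤ.+ e) ≃ 2^⁺ e * 2^⁺ e ∕ 2^⁻ e * 2^⁻ e
ratio-2^[e+e] (+ a) =
  subst (λ z → 2^ (+ (a + a)) ≃ z ∕ 1) (ℕ.^-distribˡ-+-* 2 a a) (ratio-2^ (+ (a + a)))
ratio-2^[e+e] -[1+ a ] =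
  subst (λ z → 2^ -[1+ suc (a + a) ] ≃ 1 ∕ z)
        (trans (cong (2 ^_) (cong suc (sym (ℕ.+-suc a a)))) (ℕ.^-distribˡ-+-* 2 (suc a) (suc a)))
        (ratio-2^ -[1+ suc (a + a) ])

-- Lowering the exponent by one divides δ² by 4. Zero is a separate case since its predecessor is
-- represented by the other constructor.
ratio-2^pred : ∀ e → 2^ (ℤ.pred e ℤ.+ ℤ.pred e) ≃ 2^⁺ e * 2^⁺ e ∕ 4 * (2^⁻ e * 2^⁻ e)
ratio-2^pred (+ 0)     = ratio-2^ (ℤ.- (+ 2))
ratio-2^pred (+ suc a) = ratio-resp 4 (ratio-2^[e+e] (+ a)) (eq (2 ^ a))
  where
  eq : ∀ x → x * x * 4 ≡ 2 * x * (2 * x) * 1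
  eq = solve-∀
ratio-2^pred -[1+ a ] =
  subst (λ z → 2^ (-[1+ suc a ] ℤ.+ -[1+ suc a ]) ≃ 1 ∕ z) (eq (2 ^ suc a)) (ratio-2^[e+e] -[1+ suc a ])
  where
  eq : ∀ x → 2 * x * (2 * x) ≡ 4 * (x * x)
  eq = solve-∀

-- Frequency moments

F≡r*t : (M : Matrix r t n) → F M 1 ≡ r * t
F≡r*t {r} {t} {n} M = begin
  ∑[ l < n ] (freq M l ^ 1)          ≡⟨ sum-by-value M (λ _ → 1) ⟨
  ∑[ i < r ] ∑[ j < t ] 1            ≡⟨ sum-cong-≗ {r} (λ _ → trans (sum-const t 1) (ℕ.*-identityʳ t)) ⟩
  ∑[ i < r ] t                       ≡⟨ sum-const r t ⟩
  r * t                              ∎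
  where open ≡-Reasoning

module _ (M : Matrix r t (suc n)) where

  otherFreq : Fin n → ℕ
  otherFreq l = freq M (suc l)

  G≡μ : ∀ k → G M k ≡ μ otherFreq k
  G≡μ k = ℕ.m+n∸m≡n (f₁ M ^ k) (μ otherFreq k)

  F₁≡f₁+μ₁ : F M 1 ≡ f₁ M + μ otherFreq 1
  F₁≡f₁+μ₁ = cong (_+ μ otherFreq 1) (ℕ.^-identityʳ (f₁ M))

  #drop≤ : ∀ lam → #drop M lam ≤ f₁ M * f₁ M + μ otherFreq 2
  #drop≤ lam = ℕ.≤-trans (#drop≤F₂ M lam) (ℕ.+-monoʳ-≤ (f₁ M * f₁ M)
    (ℕ.≤-reflexive (sum-cong-≗ (λ l → cong (otherFreq l *_) (sym (ℕ.*-identityʳ (otherFreq l)))))))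

  lam*#block≤ : ∀ lam → lam * #block M lam ≤ μ otherFreq 3
  lam*#block≤ lam = ℕ.≤-trans (lam*#block≤G₃ M lam) (ℕ.≤-reflexive (cong₂ _+_ (ℕ.*-zeroʳ (f₁ M))
    (sum-cong-≗ (λ l → eq (otherFreq l)))))
    where
    eq : ∀ x → x * (1 * (x * x)) ≡ x * (x * (x * 1))
    eq = solve-∀

theorem3p6 : ∀ (k : ℕ) → 3 ≤ k →
    ∃₂ λ (α β : Surd k) → 0ˢ <ˢ α × 0ˢ <ˢ β ×
    (∀ (r t n : ℕ) .{{_ : NonZero r}} .{{_ : NonZero t}} .{{_ : NonZero n}}
    (M : Matrix r t n) (e : ℤ) (lam : ℕ) →
    (+ f₁ M / 1) ℚ.≤ (+ 1 / 10) ℚ.* (+ F M 1 / 1) →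
    e Is⌈½log₂ ψ k M ⌉ →
    t IsCeilingOf tReal k M e →
    + lam ≡ ceiling (lamReal M e) →
    α · G M k ^[ 1 / k ] ≤ˢ ⟪ f₁ M ⟫ →
    ⟪ f₁ M ⟫ ≤ˢ β · ⟪ t ⟫ →
    threshold k n e ≤ˢ ℙ[S≡1] M lam)
-- 16 makes the two f₁² losses at most f₁ t / 8. And 96 = 8 · 12 makes `r * lam`, at most 12 f₁ / α,
-- at most f₁ / 8.
theorem3p6 k 3≤k = ⟪ 96 ⟫ , ⟦ + 1 / 16 ⟧ , 0<α , 0<β , bound
  where
  i = k ∸ 3
  k≡ : 3 + i ≡ k
  k≡ = ℕ.m+[n∸m]≡n 3≤k

  instance
    k≢0 : NonZero k
    k≢0 = subst NonZero k≡ _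

  0<ratio : ∀ {x a b} → x ≃ a ∕ b → .{{_ : NonZero a}} → ℚ.0ℚᵘ ℚ.< x
  0<ratio {a = a} x≃ = ℚ.≰⇒> λ x≤0 →
    ℕ.<⇒≱ (>-nonZero⁻¹ a) (subst (_≤ 0) (ℕ.*-identityʳ a) (ratio-≤⁻ x≃ (ratio-/ 0 1) x≤0))

  0<α : 0ˢ {k} <ˢ ⟪ 96 ⟫
  0<α = 0<ratio (ratio-ℕ^ 96 k) {{ℕ.m^n≢0 96 k}}

  0<β : 0ˢ {k} <ˢ ⟦ + 1 / 16 ⟧
  0<β = 0<ratio (ratio-^ (ratio-/ 1 16) k) {{ℕ.m^n≢0 1 k}}

  bound : ∀ (r t n : ℕ) .{{_ : NonZero r}} .{{_ : NonZero t}} .{{_ : NonZero n}}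
    (M : Matrix r t n) (e : ℤ) (lam : ℕ) →
    (+ f₁ M / 1) ℚ.≤ (+ 1 / 10) ℚ.* (+ F M 1 / 1) →
    e Is⌈½log₂ ψ k M ⌉ →
    t IsCeilingOf tReal k M e →
    + lam ≡ ceiling (lamReal M e) →
    ⟪ 96 ⟫ · G M k ^[ 1 / k ] ≤ˢ ⟪ f₁ M ⟫ →
    ⟪_⟫ {k} (f₁ M) ≤ˢ ⟦ + 1 / 16 ⟧ · ⟪ t ⟫ →
    threshold k n e ≤ˢ ℙ[S≡1] M lam
  bound r t n@(suc m) M e lam f≤F/10 (ψ≤2^ , ⌈ψ⌉) (τ≤t , ⌈τ⌉) lam≡ αG≤f f≤βt =
    ratio-≤⁺ ratio-threshold ratio-ℙ
      (subst₂ _≤_ (cong (_* (t ^ r) ^ k) (sym (ℕ.*-identityʳ (P ^ k)))) (eq-goal (c ^ k) (Q ^ k) (2 ^ k) n^[k-2])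
         outcomes≤)
    where
    f = f₁ M
    F₁ = F M 1
    Gₖ = G M k
    P = 2^⁺ e
    Q = 2^⁻ e
    v = n ^ i
    c = #S≡one M lam
    n^[k-2] = n ^ (k ∸ 2)
    R = t ^ r
    instance
      P≢0 : NonZero P
      P≢0 = 2^⁺≢0 e
      Q≢0 : NonZero Q
      Q≢0 = 2^⁻≢0 e
      v≢0 : NonZero v
      v≢0 = ℕ.m^n≢0 n i
      F₁≢0 : NonZero F₁
      F₁≢0 = F₁-nonZero M

    n^[k-1]≡ : n ^ (k ∸ 1) ≡ n * n * v
    n^[k-1]≡ = trans (cong (λ k → n ^ (k ∸ 1)) (sym k≡)) (sym (ℕ.*-assoc n n v))
    n^k≡ : n ^ k ≡ n * n * n * v
    n^k≡ = trans (cong (n ^_) (sym k≡)) (eq n v)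
      where
      eq : ∀ n v → n * (n * (n * v)) ≡ n * n * n * v
      eq = solve-∀
    n^[k-2]≡ : n ^ (k ∸ 2) ≡ n * v
    n^[k-2]≡ = cong (λ k → n ^ (k ∸ 2)) (sym k≡)

    ratio-ψ : radicand (ψ k M) ≃ n * n * v * Gₖ ∕ F₁ ^ k
    ratio-ψ = ratio-cong
      (trans (ℕ.*-identityʳ _) (cong₂ _*_ n^[k-1]≡ (ℕ.^-identityʳ Gₖ)))
      (ℕ.*-identityˡ (F₁ ^ k))
      (ratio-÷ {{^ℚ-nonZero (+ F₁ / 1) k}} (ratio-* (ratio-/ (n ^ (k ∸ 1)) 1) (ratio-/ (Gₖ ^ 1) 1)) (ratio-ℕ^ F₁ k))

    ratio-4^e : radicand (2^ˢ {k} (e ℤ.+ e)) ≃ P ^ k * P ^ k ∕ Q ^ k * Q ^ k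
    ratio-4^e = ratio-cong (^-distribʳ-* P P k) (^-distribʳ-* Q Q k) (ratio-^ (ratio-2^[e+e] e) k)

    ratio-4^[e-1] : radicand (2^ˢ {k} (ℤ.pred e ℤ.+ ℤ.pred e)) ≃ P ^ k * P ^ k ∕ 4 ^ k * (Q ^ k * Q ^ k)
    ratio-4^[e-1] = ratio-cong (^-distribʳ-* P P k)
      (trans (^-distribʳ-* 4 (Q * Q) k) (cong (4 ^ k *_) (^-distribʳ-* Q Q k))) (ratio-^ (ratio-2^pred e) k)

    ratio-t : radicand (tReal k M e) ≃ P ^ k * F₁ ^ k ∕ Q ^ k * n
    ratio-t = ratio-cong (ℕ.*-identityʳ _) (cong₂ _*_ (ℕ.*-identityʳ (Q ^ k)) (ℕ.^-identityʳ n))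
      (ratio-÷ {y = + (n ^ 1) / 1} (ratio-* (ratio-^ (ratio-2^ e) k) (ratio-ℕ^ F₁ k)) (ratio-/ (n ^ 1) 1))

    ratio-lam : lamReal M e ≃ F₁ * (P * P * P) ∕ Q * Q * Q * n
    ratio-lam = ratio-cong (eq₁ F₁ P) (eq₂ Q n)
      (ratio-÷ {y = + n / 1} (ratio-* (ratio-/ F₁ 1) (ratio-^ (ratio-2^ e) 3)) (ratio-/ n 1))
      where
      eq₁ : ∀ F P → F * (P * (P * (P * 1))) * 1 ≡ F * (P * P * P)
      eq₁ = solve-∀
      eq₂ : ∀ Q n → 1 * (Q * (Q * (Q * 1))) * n ≡ Q * Q * Q * n
      eq₂ = solve-∀

    ratio-threshold : radicand (threshold k n e) ≃ P ^ k * 1 ∕ Q ^ k * (2 ^ k * n^[k-2])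
    ratio-threshold = ratio-÷
      {{*-nonZero ((+ 2 / 1) ^ℚ k) (+ n^[k-2] / 1) {{^ℚ-nonZero (+ 2 / 1) k}} {{ℕ.m^n≢0 n (k ∸ 2)}}}}
      (ratio-^ (ratio-2^ e) k)
      (ratio-* (ratio-ℕ^ 2 k) (ratio-/ n^[k-2] 1))

    ratio-ℙ : radicand (ℙ[S≡1] {k = k} M lam) ≃ c ^ k ∕ R ^ k
    ratio-ℙ = ratio-^ (ratio-cong (length-filter-outcomes r (S≡one? M lam)) refl
      (ratio-/ _ R {{ℕ.m^n≢0 t r}})) k

    ψ≤δ² : n * n * v * Gₖ * (Q ^ k * Q ^ k) ≤ F₁ ^ k * (P ^ k * P ^ k)
    ψ≤δ² = ℕ.≤-trans (ratio-≤⁻ ratio-ψ ratio-4^e ψ≤2^) (ℕ.≤-reflexive (ℕ.*-comm (P ^ k * P ^ k) (F₁ ^ k)))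

    δ²≤4ψ : F₁ ^ k * (P ^ k * P ^ k) ≤ 4 ^ k * (n * n * v * Gₖ * (Q ^ k * Q ^ k))
    δ²≤4ψ = subst₂ _≤_ (ℕ.*-comm (P ^ k * P ^ k) (F₁ ^ k)) (eq (n * n * v * Gₖ) (4 ^ k) (Q ^ k * Q ^ k))
      -- By minimality of `e`, the exponent `e - 1` is too small, so ψ is at least δ² / 4.
      (ratio-≰⁻ ratio-ψ ratio-4^[e-1] (λ ψ≤ → ℤ.<-irrefl refl (ℤ.i≤pred[j]⇒i<j (⌈ψ⌉ (ℤ.pred e) ψ≤))))
      where
      eq : ∀ x y z → x * (y * z) ≡ y * (x * z)
      eq = solve-∀

    t-order : ∀ x y z → x * (y * z) ≡ z * x * y
    t-order = solve-∀

    τ≤t′ : P ^ k * F₁ ^ k ≤ n * t ^ k * Q ^ k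
    τ≤t′ = subst₂ _≤_ (ℕ.*-identityʳ _) (t-order (t ^ k) (Q ^ k) n) (ratio-≤⁻ ratio-t (ratio-ℕ^ t k) τ≤t)

    t-1≤τ : n * (t ∸ 1) ^ k * Q ^ k ≤ P ^ k * F₁ ^ k
    t-1≤τ = subst₂ _≤_ (t-order ((t ∸ 1) ^ k) (Q ^ k) n) (ℕ.*-identityʳ _)
      (ratio-≰⁻ ratio-t (ratio-ℕ^ (t ∸ 1) k) (λ τ≤ → ℕ.<⇒≱ (ℕ.≤-reflexive (ℕ.suc-pred t)) (⌈τ⌉ (t ∸ 1) τ≤)))

    lam-order : ∀ x y z → x * (y * z) ≡ x * z * y
    lam-order = solve-∀

    ≤lam : F₁ * (P * P * P) ≤ lam * n * (Q * Q * Q)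
    ≤lam = ℕ.≤-trans (proj₁ (ratio-ceiling ratio-lam lam≡)) (ℕ.≤-reflexive (lam-order lam (Q * Q * Q) n))

    lam≤ : lam * n * (Q * Q * Q) ≤ F₁ * (P * P * P) + n * (Q * Q * Q)
    lam≤ = subst₂ _≤_ (lam-order lam (Q * Q * Q) n) (cong (λ x → F₁ * (P * P * P) + x) (ℕ.*-comm (Q * Q * Q) n))
      (proj₂ (ratio-ceiling ratio-lam lam≡))

    10f≤F : 10 * f ≤ F₁
    10f≤F = subst₂ _≤_ (ℕ.*-comm f 10) (trans (ℕ.*-identityʳ (1 * F₁)) (ℕ.*-identityˡ F₁))
      (ratio-≤⁻ (ratio-/ f 1) (ratio-* (ratio-/ 1 10) (ratio-/ F₁ 1)) f≤F/10)

    αG≤f′ : 96 ^ k * Gₖ ≤ f ^ k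
    αG≤f′ = subst₂ _≤_ (trans (ℕ.*-identityʳ _) (cong (96 ^ k *_) (ℕ.^-identityʳ Gₖ))) (ℕ.*-identityʳ (f ^ k))
      (ratio-≤⁻ (ratio-* (ratio-ℕ^ 96 k) (ratio-/ (Gₖ ^ 1) 1)) (ratio-ℕ^ f k) αG≤f)

    16f≤t : 16 * f ≤ t
    16f≤t = ^-cancelˡ-≤ k (subst₂ _≤_
      (trans (eq₁ (f ^ k) (16 ^ k)) (sym (^-distribʳ-* 16 f k)))
      (trans (cong (λ x → x * t ^ k * 1) (ℕ.^-zeroˡ k)) (eq₂ (t ^ k)))
      (ratio-≤⁻ (ratio-ℕ^ f k) (ratio-* (ratio-^ (ratio-/ 1 16) k) (ratio-ℕ^ t k)) f≤βt))
      where
      eq₁ : ∀ x y → x * (y * 1) ≡ y * x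
      eq₁ = solve-∀
      eq₂ : ∀ x → 1 * x * 1 ≡ x
      eq₂ = solve-∀

    G₃^k≤ : μ (otherFreq M) 3 ^ k ≤ v * (Gₖ * Gₖ * Gₖ)
    G₃^k≤ = begin
      μ (otherFreq M) 3 ^ k
        ≤⟨ subst (λ k → μ (otherFreq M) 3 ^ k ≤ μ (otherFreq M) 0 ^ i * μ (otherFreq M) k ^ 3) k≡ (μ₃-powerMean (otherFreq M) i) ⟩
      μ (otherFreq M) 0 ^ i * μ (otherFreq M) k ^ 3
        -- The zeroth moment counts the n - 1 values other than 1.
        ≤⟨ ℕ.*-mono-≤ (ℕ.^-monoˡ-≤ i (ℕ.≤-trans (ℕ.≤-reflexive (trans (sum-const m 1) (ℕ.*-identityʳ m))) (ℕ.n≤1+n m)))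
                      (ℕ.≤-reflexive (trans (cong (_^ 3) (sym (G≡μ M k))) (cube Gₖ))) ⟩
      v * (Gₖ * Gₖ * Gₖ) ∎
      where
      open ℕ.≤-Reasoning
      cube : ∀ g → g * (g * (g * 1)) ≡ g * g * g
      cube = solve-∀

    eq-goal : ∀ c q x y → c * (x * y * q) ≡ c * (q * (x * y))
    eq-goal = solve-∀

    open Numerics k n v r t lam f Gₖ (μ (otherFreq M) 1) (μ (otherFreq M) 2) (μ (otherFreq M) 3) F₁ P Q 96
      n^k≡ (F≡r*t M) (F₁≡f₁+μ₁ M) 10f≤F (μ-mono-exponent (otherFreq M) 0 2) (μ-logConvex (otherFreq M) 1) G₃^k≤
      ψ≤δ² δ²≤4ψ τ≤t′ t-1≤τ ≤lam lam≤ ℕ.≤-refl αG≤f′ 16f≤t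

    outcomes≤ : P ^ k * R ^ k ≤ c ^ k * (2 ^ k * n^[k-2] * Q ^ k)
    outcomes≤ = subst (λ x → P ^ k * R ^ k ≤ c ^ k * (2 ^ k * x * Q ^ k)) (sym n^[k-2]≡)
      (conclusion R c (#good M lam) (#twin M lam) (#block M lam) (#drop M lam)
        (good≤#S≡one+conflicts M lam) (f₁≤#good+lam*r M lam) (ℕ.≤-reflexive (#twin≡f₁² M lam))
        (lam*#block≤ M lam) (#drop≤ M lam))
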